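{- Let $X$ and $Y$ be $\emptyset$-hyperdefinable sets with $X\perp_\emptyset Y$. Then $X\cup Y$ has weak elimination of hyperimaginaries with respect to $X^{heq}$ and $Y^{heq}$: for every $z\in(X\cup Y)^{heq}$ there are $x\in\mathrm{bdd}_X(z)$ and $y\in\mathrm{bdd}_Y(z)$ with $z\in\mathrm{dcl}^{heq}(xy)$.
   Context: Work in a $\kappa$-saturated, strongly $\kappa$-homogeneous monster model $\mathfrak M$ for a very large $\kappa$; "bounded" means of cardinality $<\kappa$. A countable equivalence relation over $A$ is an equivalence relation given by a conjunction of countably many formulas over $A$ (in countably many variables). A hyperimaginary of type $E$ is the class $a_E$ of a tuple $a$ modulo a countable equivalence relation $E$ over $\emptyset$; tuples (possibly infinite) of hyperimaginaries are allowed, and all tuples and parameter sets are hyperimaginary unless otherwise stated. A hyperimaginary $e$ is definable (resp. bounded) over a set $B$ of hyperimaginaries if every automorphism of $\mathfrak M$ fixing $B$ pointwise fixes $e$ (resp. the orbit of $e$ under such automorphisms is bounded); $\mathrm{dcl}^{heq}(B)$ and $\mathrm{bdd}(B)$ denote the sets of hyperimaginaries definable, resp. bounded, over $B$. Two tuples of hyperimaginaries have the same type over $B$ iff they are conjugate by an automorphism fixing $B$ pointwise. A set $X$ is hyperdefinable over $A$ if $X=Z/E$ where $Z$ is type-definable over $A$ in countably many variables and $E$ is a countable equivalence relation on $Z$ over $A$. For $X$ hyperdefinable over $\emptyset$, $X^{heq}$ is the set of hyperimaginaries in $\mathrm{dcl}^{heq}(x)$ for tuples $x$ from $X$; $\mathrm{dcl}^{heq}_X(B)=\mathrm{dcl}^{heq}(B)\cap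 X^{heq}$ and $\mathrm{bdd}_X(B)=\mathrm{bdd}(B)\cap X^{heq}$; $(X\cup Y)^{heq}$ is the set of hyperimaginaries definable over tuples from $X\cup Y$. $X\perp_A Y$ (orthogonality over $A$) means: for all tuples $a$ from $X$ and $b$ from $Y$, $\mathrm{tp}(a/A)\cup\mathrm{tp}(b/A)\vdash\mathrm{tp}(ab/A)$. -}

module Defs where

open import Level using (0ℓ) renaming (suc to lsuc)
open import Data.Bool using (Bool)
open import Data.Empty using (⊥)
open import Data.Fin using (Fin)
open import Data.List using (List)
open import Data.List.Relation.Unary.All using (All)
open import Data.Nat using (ℕ; suc)
open import Data.Product using (Σ; Σ-syntax; ∃-syntax; _×_; _,_; proj₁)
open import Data.Sum using (_⊎_; [_,_]′)
open import Data.Unit using (⊤; tt)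
open import Data.Vec as Vec using (Vec; []; _∷_)
open import Function using (_∘_; const)
open import Function.Bundles using (Injection; Inverse; _↔_; _⇔_)
open import Induction.WellFounded using (WellFounded)
open import Relation.Binary using (Rel; Setoid; IsEquivalence; IsStrictTotalOrder)
open import Relation.Binary.Construct.On as On using ()
open import Relation.Binary.PropositionalEquality using (_≡_; setoid)
open import Relation.Nullary using (¬_)
open import Relation.Unary using (Pred; _∈_; _∩_)

-- A cardinal is an initial ordinal: a well-ordered set that does not
-- embed into any of its proper initial segments.

record Cardinal : Set₁ where
  field
    Carrier            : Set
    _<_                : Rel Carrier 0ℓ
    isStrictTotalOrder : IsStrictTotalOrder _≡_ _<_
    wellFounded        : WellFounded _<_
    initial            : ∀ k → ¬ Injection (setoid Carrier) (setoid (Σ[ j ∈ Carrier ] j < k))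

-- S ≺ κ: the set S (elements counted up to the setoid equality) has
-- cardinality < κ.

infix 4 _≺_

_≺_ : Setoid 0ℓ 0ℓ → Cardinal → Set
S ≺ κ = Injection S K × ¬ Injection K S
  where K = setoid (Cardinal.Carrier κ)

record Language : Set₁ where
  field
    Fn      : Set
    fnArity : Fn → ℕ
    Rl      : Set
    rlArity : Rl → ℕ

module _ (L : Language) where
  open Language L

  data Term (n : ℕ) : Set where
    var : Fin n → Term n
    fn  : (f : Fn) → Vec (Term n) (fnArity f) → Term n

  -- De Bruijn formulas with free variables in Fin n.  The metatheory is
  -- classical, so the other connectives are definable from these.
  data Formula (n : ℕ) : Set where
    falsum : Formula n
    _≐_    : Term n → Term n → Formula n
    rl     : (r : Rl) → Vec (Term n) (rlArity r) → Formula n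
    _⇒_    : Formula n → Formula n → Formula n
    all    : Formula (suc n) → Formula n

  -- A formula whose free variables are named by elements of an arbitrary
  -- (possibly infinite) set V.
  record FormulaIn (V : Set) : Set where
    constructor _at_
    field
      {arity} : ℕ
      formula : Formula arity
      vars    : Vec V arity

record Structure (L : Language) : Set₁ where
  open Language L
  field
    Carrier : Set
    ⟦fn⟧    : (f : Fn) → Vec Carrier (fnArity f) → Carrier
    ⟦rl⟧    : (r : Rl) → Vec Carrier (rlArity r) → Set

module Semantics {L : Language} (M : Structure L) where
  open Language L
  open Structure M

  mutual
    eval : ∀ {n} → Vec Carrier n → Term L n → Carrier
    eval ρ (var i)   = Vec.lookup ρ i
    eval ρ (fn f ts) = ⟦fn⟧ f (evals ρ ts)

    evals : ∀ {n k} → Vec Carrier n → Vec (Term L n) k → Vec Carrier k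
    evals ρ []       = []
    evals ρ (t ∷ ts) = eval ρ t ∷ evals ρ ts

  Sat : ∀ {n} → Formula L n → Vec Carrier n → Set
  Sat falsum    ρ = ⊥
  Sat (s ≐ t)   ρ = eval ρ s ≡ eval ρ t
  Sat (rl r ts) ρ = ⟦rl⟧ r (evals ρ ts)
  Sat (φ ⇒ ψ)   ρ = Sat φ ρ → Sat ψ ρ
  Sat (all φ)   ρ = ∀ m → Sat φ (m ∷ ρ)

  infix 4 _⊨_

  _⊨_ : {V : Set} → (V → Carrier) → FormulaIn L V → Set
  a ⊨ (φ at vs) = Sat φ (Vec.map a vs)

  record Automorphism : Set where
    field
      bijection : Carrier ↔ Carrier
    open Inverse bijection using (to) public
    field
      preserves-fn : ∀ f ms → to (⟦fn⟧ f ms) ≡ ⟦fn⟧ f (Vec.map to ms)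
      preserves-rl : ∀ r ms → ⟦rl⟧ r ms ⇔ ⟦rl⟧ r (Vec.map to ms)

  -- Every finitely satisfiable set of formulas in one variable (inj₁ tt)
  -- over fewer than κ parameters a is realised.
  Saturated : Cardinal → Set₁
  Saturated κ =
    (I : Set) → setoid I ≺ κ → (a : I → Carrier) →
    (p : Pred (FormulaIn L (⊤ ⊎ I)) 0ℓ) →
    ((φs : List (FormulaIn L (⊤ ⊎ I))) → All p φs →
       ∃[ m ] All ([ const m , a ]′ ⊨_) φs) →
    ∃[ m ] (∀ φ → p φ → [ const m , a ]′ ⊨ φ)

  StronglyHomogeneous : Cardinal → Set₁
  StronglyHomogeneous κ =
    (I : Set) → setoid I ≺ κ → (a b : I → Carrier) →
    (∀ φ → a ⊨ φ ⇔ b ⊨ φ) →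
    Σ[ σ ∈ Automorphism ] (∀ i → Automorphism.to σ (a i) ≡ b i)

-- "κ very large" is read as 2^|L| < κ, where |L| is the number of
-- L-formulas (so |L| ≥ ℵ₀).

record MonsterModel : Set₁ where
  field
    L           : Language
    κ           : Cardinal
    large       : setoid (FormulaIn L ℕ → Bool) ≺ κ
    𝔐           : Structure L
    saturated   : Semantics.Saturated 𝔐 κ
    homogeneous : Semantics.StronglyHomogeneous 𝔐 κ

module Hyperimaginaries (𝕄 : MonsterModel) where
  open MonsterModel 𝕄
  open Semantics 𝔐 public

  -- Countable tuples are indexed by ℕ; a finite tuple is padded by
  -- coordinates that the formulas do not mention.
  ωTuple : Set
  ωTuple = ℕ → Structure.Carrier 𝔐

  infixr 9 _·_

  _·_ : Automorphism → ωTuple → ωTuple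
  σ · a = Automorphism.to σ ∘ a

  -- A conjunction of countably many formulas over ∅ in two ω-tuples of
  -- variables.
  CountableRelation : Set
  CountableRelation = ℕ → FormulaIn L (ℕ ⊎ ℕ)

  ⟦_⟧ : CountableRelation → Rel ωTuple 0ℓ
  ⟦ E ⟧ a b = ∀ n → [ a , b ]′ ⊨ E n

  -- The class of rep modulo rel.  That rel is an equivalence relation, on
  -- all ω-tuples or on a type-definable set containing rep, is required
  -- by Hyperimaginary and HyperdefinableSet below.
  record Class : Set where
    constructor _/_
    field
      rep : ωTuple
      rel : CountableRelation

  _fixes_ : Automorphism → Class → Set
  σ fixes (a / E) = ⟦ E ⟧ (σ · a) a

  FixesPointwise : {I : Set} → Automorphism → (I → Class) → Set
  FixesPointwise σ B = ∀ i → σ fixes B i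

  record Hyperimaginary : Set where
    field
      rep           : ωTuple
      type          : CountableRelation
      isEquivalence : IsEquivalence ⟦ type ⟧

    class : Class
    class = rep / type

  open Hyperimaginary public using (class)

  -- Sets B of parameters are given as indexed families of classes.

  dcl : {I : Set} → (I → Class) → Pred Hyperimaginary 0ℓ
  dcl B e = ∀ σ → FixesPointwise σ B → σ fixes class e

  -- The orbit of e under the automorphisms fixing B pointwise, its elements
  -- being represented by such automorphisms.
  Orbit : {I : Set} → (I → Class) → Hyperimaginary → Setoid 0ℓ 0ℓ
  Orbit B e = On.setoid {B = Σ[ σ ∈ Automorphism ] FixesPointwise σ B}
    (record { isEquivalence = isEquivalence }) ((_· rep) ∘ proj₁)
    where open Hyperimaginary e

  bdd : {I : Set} → (I → Class) → Pred Hyperimaginary 0ℓ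
  bdd B e = Orbit B e ≺ κ

  -- A set Z/E hyperdefinable over ∅.  Z is given by an arbitrary set of
  -- formulas; E need only be an equivalence relation on Z.
  record HyperdefinableSet : Set₁ where
    field
      Z : Pred (FormulaIn L ℕ) 0ℓ
      E : CountableRelation

    Element : Set
    Element = Σ[ a ∈ ωTuple ] (∀ φ → Z φ → a ⊨ φ)

    element : Element → Class
    element x = proj₁ x / E

    field
      isEquivalence : IsEquivalence {A = Element} (λ x y → ⟦ E ⟧ (proj₁ x) (proj₁ y))

  open HyperdefinableSet public using (Element; element)

  -- The hyperimaginaries definable over a bounded tuple from a given
  -- collection of classes.
  heq : {P : Set} → (P → Class) → Pred Hyperimaginary (lsuc 0ℓ)
  heq {P} c e = Σ[ I ∈ Set ] (setoid I ≺ κ) × (Σ[ a ∈ (I → P) ] e ∈ dcl (c ∘ a))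

  infix 10 _^heq

  _^heq : HyperdefinableSet → Pred Hyperimaginary (lsuc 0ℓ)
  X ^heq = heq (element X)

  [_∪_]^heq : HyperdefinableSet → HyperdefinableSet → Pred Hyperimaginary (lsuc 0ℓ)
  [ X ∪ Y ]^heq = heq [ element X , element Y ]′

  bdd[_] : HyperdefinableSet → {I : Set} → (I → Class) → Pred Hyperimaginary (lsuc 0ℓ)
  bdd[ X ] B = bdd B ∩ X ^heq

  Maps : (X : HyperdefinableSet) {I : Set} → Automorphism → Rel (I → Element X) 0ℓ
  Maps X σ a a′ = ∀ i → ⟦ E ⟧ (σ · proj₁ (a i)) (proj₁ (a′ i))
    where open HyperdefinableSet X using (E)

  -- Orthogonality over ∅.  Tuples of hyperimaginaries have the same type iff
  -- they are conjugate, so the hypotheses say that a′ ⊨ tp(a) and b′ ⊨ tp(b)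
  -- and the conclusion says that a′b′ ⊨ tp(ab).
  infix 4 _⊥∅_

  _⊥∅_ : HyperdefinableSet → HyperdefinableSet → Set₁
  X ⊥∅ Y =
    (I J : Set) → setoid I ≺ κ → setoid J ≺ κ →
    (a a′ : I → Element X) (b b′ : J → Element Y) →
    (∃[ σ ] Maps X σ a a′) → (∃[ τ ] Maps Y τ b b′) →
    ∃[ ρ ] (Maps X ρ a a′ × Maps Y ρ b b′)

{-# OPTIONS --safe #-}
-- Write z = f(a , b) with a from X and b from Y.  By orthogonality a and b can be
-- moved independently, so whether f(a , b) = f(a′ , b) does not depend on b.
-- This is a type-definable equivalence relation on the conjugates of a; together
-- with its analogue on the conjugates of b it yields
-- f(a , b) = f(a′ , b) = f(a′ , b′), so the classes of a and b determine z.  By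
-- compactness countably many consequences of the two relations suffice for this,
-- and these lie in countable equivalence relations, whose classes are x and y.
-- If σ fixes z and τ fixes x, then moving a as τ does while fixing b shows that
-- τ fixes σx.  Hence each conjugate of x over z lies in dcl(x), and there are at
-- most 2^|L| of them.

module Submission where

open import Level using (0ℓ)
open import Algebra.Bundles using (Group)
open import Axiom.ExcludedMiddle using (ExcludedMiddle)
open import Axiom.Extensionality.Propositional using (Extensionality; implicit-extensionality)
open import Axiom.UniquenessOfIdentityProofs.WithK using (uip)
open import Data.Bool using (Bool)
open import Data.Empty using (⊥-elim)
open import Data.Fin as Fin using (Fin; zero; suc; _↑ˡ_; _↑ʳ_; toℕ)
open import Data.Fin.Properties using (toℕ-injective)
open import Data.List as List using (List)
open import Data.List.Relation.Unary.All as ListAll using ()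
open import Data.Nat as ℕ using (ℕ; zero; suc)
open import Data.Nat.GeneralisedArithmetic using (fold)
open import Data.Nat.Properties using (+-suc; +-identityʳ)
open import Data.Product using (Σ; Σ-syntax; ∃-syntax; _×_; _,_; proj₁; proj₂; uncurry)
open import Data.Sum as Sum using (_⊎_; inj₁; inj₂; [_,_]′)
open import Data.Sum.Properties using (inj₁-injective; inj₂-injective; swap-involutive)
open import Data.Unit using (⊤; tt)
open import Data.Vec as Vec using (Vec; _++_; lookup)
open import Data.Vec.Membership.Propositional using () renaming (_∈_ to _∈ᵛ_)
open import Data.Vec.Properties using (map-∘; map-cong; map-id; map-++; lookup-++ˡ; lookup-++ʳ; lookup-map)
open import Data.Vec.Relation.Unary.Any using (here; there; index)
open import Data.Vec.Relation.Unary.Any.Properties using (lookup-index)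
open import Function using (_∘_; id; const)
open import Function.Bundles using (Injection; Inverse; Equivalence; _⇔_; _↣_; mk↣; mk⇔)
import Function.Construct.Composition as Composition
import Function.Construct.Identity as Identity
import Function.Construct.Symmetry as Symmetry
open import Induction.WellFounded using (WellFounded; module All; module FixPoint; wf⇒asym)
open import Relation.Binary using (Rel; Setoid; IsEquivalence; IsStrictTotalOrder; tri<; tri≈; tri>)
open import Relation.Binary.Construct.On as On using ()
open import Relation.Binary.PropositionalEquality using (_≡_; refl; sym; trans; cong; cong₂; subst; setoid)
open import Relation.Nullary using (¬_; Dec; yes; no; does)
open import Relation.Nullary.Decidable using (True; toWitness; fromWitness; does-⇔)
open import Relation.Unary using (Pred; _∈_)
open import Defs

-- Countable and small sets

-- A conjugate of a tuple is represented by the automorphism producing it, so αa = βa becomes a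
-- left-invariant equivalence relation on the automorphism group, and the arguments about a, b and z
-- become group theory. Model theory enters through type-definability, treated semantically: a set
-- of assignments is closed if it contains every assignment satisfying its theory. Orbits are closed
-- by homogeneity, projections by compactness. The obstacle is length: a and b may be uncountable,
-- whereas x and y must be classes of countable tuples. So each formula in the type of z costs one
-- formula about a and one about b, and these are absorbed into two chains of symmetric formulas
-- with Θ(n+1) ∘ Θ(n+1) ⊆ Θ(n). Saturation is given for one variable only, so compactness for long
-- tuples is a transfinite recursion, and the smallness of sums and of products with ℕ is derived
-- from κ being an initial ordinal.

-- Walks along the antidiagonals.
unpair : ℕ → ℕ × ℕ
unpair zero = 0 , 0
unpair (suc k) with unpair k
... | zero  , n = suc n , 0
... | suc m , n = m , suc n

unpair-surjective : ∀ p → ∃[ k ] unpair k ≡ p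
unpair-surjective (m , n) = diagonal (m ℕ.+ n) m n refl
  where
  diagonal : ∀ s m n → m ℕ.+ n ≡ s → ∃[ k ] unpair k ≡ (m , n)
  diagonal zero    zero zero _ = 0 , refl
  diagonal (suc s) m zero eq with trans (sym (+-identityʳ m)) eq
  ... | refl with diagonal s zero s refl
  ...   | k , e = suc k , step
    where
    step : unpair (suc k) ≡ (suc s , 0)
    step rewrite e = refl
  diagonal s m (suc n) eq with diagonal s (suc m) n (trans (sym (+-suc m n)) eq)
  ... | k , e = suc k , step
    where
    step : unpair (suc k) ≡ (m , suc n)
    step rewrite e = refl

pair : ℕ × ℕ → ℕ
pair = proj₁ ∘ unpair-surjective

unpair-pair : ∀ p → unpair (pair p) ≡ p
unpair-pair = proj₂ ∘ unpair-surjective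

pair-injective : ∀ p q → pair p ≡ pair q → p ≡ q
pair-injective p q e = trans (sym (unpair-pair p)) (trans (cong unpair e) (unpair-pair q))

module _ (em : ExcludedMiddle 0ℓ) (ext : Extensionality 0ℓ 0ℓ) where

  -- The choice at `s` may depend on earlier ones. Locality lets a condition on the finished
  -- function be checked on its values below `s`, the only ones available when the choice is made.
  wf-choice :
    ∀ {S A : Set} {_<_ : S → S → Set} → WellFounded _<_ → (S → A) →
    (P : S → (S → A) → A → Set) →
    (∀ {s f g a} → (∀ t → t < s → f t ≡ g t) → P s f a → P s g a) →
    Σ[ f ∈ (S → A) ] (∀ s → (∃[ a ] P s f a) → P s f (f s))
  wf-choice {S} {A} {_<_} wf default P local = f , correct
    where
    extend : ∀ s → (∀ {t} → t < s → A) → S → A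
    extend s c t with em {t < s}
    ... | yes t<s = c t<s
    ... | no _ = default t

    pick : ∀ s → (S → A) → A
    -- `em` decides the Σ-type itself, so its positive answer carries a witness and acts as a choice
    -- function.
    pick s g with em {∃[ a ] P s g a}
    ... | yes (a , _) = a
    ... | no _ = default s

    step : ∀ s → (∀ {t} → t < s → A) → A
    step s c = pick s (extend s c)

    f : S → A
    f = All.wfRec wf 0ℓ (λ _ → A) step

    unfold : ∀ s → f s ≡ pick s (extend s (λ {t} _ → f t))
    unfold s = FixPoint.unfold-wfRec wf (λ _ → A) step
      (λ s c≗c′ → cong (λ (c : ∀ {t} → t < s → A) → step s c)
        (implicit-extensionality ext (ext c≗c′))) {s}

    extend-≗ : ∀ s t → t < s → f t ≡ extend s (λ {t} _ → f t) t
    extend-≗ s t t<s with em {t < s}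
    ... | yes _ = refl
    ... | no t≮s = ⊥-elim (t≮s t<s)

    pick-correct : ∀ s g → (∃[ a ] P s g a) → P s g (pick s g)
    pick-correct s g e with em {∃[ a ] P s g a}
    ... | yes (_ , p) = p
    ... | no none = ⊥-elim (none e)

    correct : ∀ s → (∃[ a ] P s f a) → P s f (f s)
    correct s (a , p) = subst (P s f) (sym (unfold s))
      (local (λ t t<s → sym (extend-≗ s t t<s))
        (pick-correct s _ (a , local (extend-≗ s) p)))

module Cardinals (em : ExcludedMiddle 0ℓ) (ext : Extensionality 0ℓ 0ℓ) (κ : Cardinal) where
  open Cardinal κ
  open IsStrictTotalOrder isStrictTotalOrder using (compare) renaming (trans to <-trans)

  ≺-injection : ∀ {S T : Setoid 0ℓ 0ℓ} → Injection S T → T ≺ κ → S ≺ κ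
  ≺-injection f (g , ¬h) = Composition.injection f g , λ h → ¬h (Composition.injection h f)

  infix 0 _≺κ
  _≺κ : Set → Set
  S ≺κ = setoid S ≺ κ

  ≺κ-↣ : ∀ {S T} → S ↣ T → T ≺κ → S ≺κ
  ≺κ-↣ = ≺-injection

  Least : (Carrier → Set) → Carrier → Set
  Least P k = P k × (∀ j → j < k → ¬ P j)

  least : (P : Carrier → Set) → ∀ k → P k → ∃[ j ] Least P j
  least P = All.wfRec wellFounded 0ℓ (λ k → P k → ∃[ j ] Least P j) step
    where
    step : ∀ k → (∀ {j} → j < k → P j → ∃[ j ] Least P j) → P k → ∃[ j ] Least P j
    step k rec p with em {∃[ j ] j < k × P j}
    ... | yes (j , j<k , q) = rec j<k q
    ... | no none = k , p , λ j j<k q → none (j , j<k , q)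

  -- The order of κ need not be proof-irrelevant, hence the Boolean test.
  Seg : Carrier → Set
  Seg k = Σ[ j ∈ Carrier ] True (em {j < k})

  Seg-≡ : ∀ {k} {s t : Seg k} → proj₁ s ≡ proj₁ t → s ≡ t
  Seg-≡ {k} {j , p} {.j , q} refl = cong (j ,_) (irr p q)
    where
    irr : ∀ {P : Set} {d : Dec P} (p q : True d) → p ≡ q
    irr {d = yes _} _ _ = refl

  segment : ∀ {S : Set} {k} (f : S → Carrier) → (∀ {s t} → f s ≡ f t → s ≡ t) →
            (∀ s → f s < k) → S ↣ Seg k
  segment f inj below = mk↣ {to = λ s → f s , fromWitness (below s)} (inj ∘ cong proj₁)

  Seg-≺κ : ∀ k → Seg k ≺κ
  Seg-≺κ k = mk↣ Seg-≡ ,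
    λ h → initial k (Composition.injection h (mk↣ {to = λ s → proj₁ s , toWitness (proj₂ s)}
      (λ {s} {t} e → Seg-≡ {k} {s} {t} (cong proj₁ e))))

  module Collapse {S : Set} (ι : S ↣ Carrier) (¬κ↣S : ¬ (Carrier ↣ S)) where
    infix 4 _⊏_
    _⊏_ : S → S → Set
    s ⊏ t = Injection.to ι s < Injection.to ι t

    ⊏-wellFounded : WellFounded _⊏_
    ⊏-wellFounded = On.wellFounded (Injection.to ι) wellFounded

    New : S → (S → Carrier) → Carrier → Set
    New s c = Least (λ k → ∀ t → t ⊏ s → ¬ c t ≡ k)

    New-local : ∀ {s f g a} → (∀ t → t ⊏ s → f t ≡ g t) → New s f a → New s g a
    New-local f≗g (new , min) =
      (λ t t⊏s e → new t t⊏s (trans (f≗g t t⊏s) e)) ,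
      (λ j j<a new′ → min j j<a (λ t t⊏s e → new′ t t⊏s (trans (sym (f≗g t t⊏s)) e)))

    recursion : Σ[ c ∈ (S → Carrier) ] (∀ s → (∃[ k ] New s c k) → New s c (c s))
    recursion = wf-choice em ext ⊏-wellFounded (Injection.to ι) New New-local

    collapse : S → Carrier
    collapse = proj₁ recursion

    not-onto : (Q : S → Set) → ¬ (∀ k → ∃[ s ] Q s × collapse s ≡ k)
    not-onto Q onto = ¬κ↣S (mk↣ {to = λ k → proj₁ (onto k)}
      (λ {j} {k} e → trans (sym (proj₂ (proj₂ (onto j))))
        (trans (cong collapse e) (proj₂ (proj₂ (onto k))))))

    -- Since `κ` does not embed in `S`, the values of `collapse` never exhaust `κ`. With `Q` the
    -- elements below `s` this gives a candidate for the next value; with `Q` everything it bounds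
    -- the image.
    missed : (Q : S → Set) → ∃[ k ] (∀ s → Q s → ¬ collapse s ≡ k)
    missed Q with em {∃[ k ] (∀ s → Q s → ¬ collapse s ≡ k)}
    ... | yes p = p
    ... | no none = ⊥-elim (not-onto Q attained)
      where
      attained : ∀ k → ∃[ s ] Q s × collapse s ≡ k
      attained k with em {∃[ s ] Q s × collapse s ≡ k}
      ... | yes p = p
      ... | no ¬p = ⊥-elim (none (k , λ s q e → ¬p (s , q , e)))

    collapse-new : ∀ s → New s collapse (collapse s)
    collapse-new s = proj₂ recursion s
      (least _ (proj₁ (missed (_⊏ s))) (proj₂ (missed (_⊏ s))))

    collapse-injective : ∀ {s t} → collapse s ≡ collapse t → s ≡ t
    collapse-injective {s} {t} e with compare (Injection.to ι s) (Injection.to ι t)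
    ... | tri< s⊏t _ _ = ⊥-elim (proj₁ (collapse-new t) s s⊏t e)
    ... | tri≈ _ ιs≡ιt _ = Injection.injective ι ιs≡ιt
    ... | tri> _ _ t⊏s = ⊥-elim (proj₁ (collapse-new s) t t⊏s (sym e))

    collapse-downward : ∀ s j → j < collapse s → ∃[ t ] collapse t ≡ j
    collapse-downward s j j<c with em {∃[ t ] collapse t ≡ j}
    ... | yes p = p
    ... | no ¬p = ⊥-elim (proj₂ (collapse-new s) j j<c (λ t _ e → ¬p (t , e)))

    bound : Carrier
    bound = proj₁ (missed (λ _ → ⊤))

    collapse-bounded : ∀ s → collapse s < bound
    collapse-bounded s with compare (collapse s) bound
    ... | tri< c<b _ _ = c<b
    ... | tri≈ _ c≡b _ = ⊥-elim (proj₂ (missed (λ _ → ⊤)) s tt c≡b)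
    ... | tri> _ _ b<c with collapse-downward s bound b<c
    ...   | t , e = ⊥-elim (proj₂ (missed (λ _ → ⊤)) t tt e)

  -- The image of the transitive collapse of S is an initial segment of κ, and
  -- a proper one because S ≺ κ.
  ≺κ⇒↣Seg : ∀ {S} → S ≺κ → ∃[ k ] S ↣ Seg k
  ≺κ⇒↣Seg (ι , ¬κ↣S) = bound , segment collapse collapse-injective collapse-bounded
    where open Collapse ι ¬κ↣S

  -- (x , n) with x = fᵐ(y), y outside the range of f, is sent to f^⟨m,n⟩(y).
  absorb-ℕ : ∀ {A : Set} (f : A → A) → (∀ {x y} → f x ≡ f y → x ≡ y) →
             (∀ x → ∃[ m ] ∃[ y ] fold y f m ≡ x × (∀ w → ¬ f w ≡ y)) → (A × ℕ) ↣ A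
  absorb-ℕ {A} f f-inj decompose = mk↣ inj
    where
    to : A × ℕ → A
    to (x , n) with decompose x
    ... | m , y , _ = fold y f (pair (m , n))

    cancel : ∀ p q {y z} → (∀ w → ¬ f w ≡ y) → (∀ w → ¬ f w ≡ z) →
             fold y f p ≡ fold z f q → p ≡ q × y ≡ z
    cancel zero    zero    y∉ z∉ e = refl , e
    cancel zero    (suc q) y∉ z∉ e = ⊥-elim (y∉ _ (sym e))
    cancel (suc p) zero    y∉ z∉ e = ⊥-elim (z∉ _ e)
    cancel (suc p) (suc q) y∉ z∉ e with cancel p q y∉ z∉ (f-inj e)
    ... | p≡q , y≡z = cong suc p≡q , y≡z

    inj : ∀ {s t} → to s ≡ to t → s ≡ t
    inj {x , n} {x′ , n′} e with decompose x | decompose x′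
    ... | m , y , eq , y∉ | m′ , y′ , eq′ , y′∉
      with cancel (pair (m , n)) (pair (m′ , n′)) y∉ y′∉ e
    ... | pq , refl with pair-injective (m , n) (m′ , n′) pq
    ... | refl = cong (_, n) (trans (sym eq) eq′)

  -- A limit ordinal is a disjoint union of copies of ω, each made of the finite successors of an
  -- element that is not a successor. This is the decomposition that `absorb-ℕ` needs.
  module Limit (k : Carrier) (unbounded : ∀ j → j < k → ∃[ i ] j < i × i < k) where
    next : ∀ (s : Seg k) → ∃[ i ] Least (λ i → proj₁ s < i × i < k) i
    next (j , j<k) = let i , p = unbounded j (toWitness j<k) in least _ i p

    succ : Seg k → Seg k
    succ s = proj₁ (next s) , fromWitness (proj₂ (proj₁ (proj₂ (next s))))

    <-succ : ∀ s → proj₁ s < proj₁ (succ s)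
    <-succ s = proj₁ (proj₁ (proj₂ (next s)))

    succ-≮ : ∀ (s t : Seg k) → proj₁ s < proj₁ t → ¬ proj₁ t < proj₁ (succ s)
    succ-≮ s t s<t t<s′ = proj₂ (proj₂ (next s)) (proj₁ t) t<s′ (s<t , toWitness (proj₂ t))

    succ-injective : ∀ {s t} → succ s ≡ succ t → s ≡ t
    succ-injective {s} {t} e with compare (proj₁ s) (proj₁ t)
    ... | tri< s<t _ _ = ⊥-elim (succ-≮ s t s<t (subst (λ (u : Seg k) → proj₁ t < proj₁ u) (sym e) (<-succ t)))
    ... | tri≈ _ s≡t _ = Seg-≡ {k} {s} {t} s≡t
    ... | tri> _ _ t<s = ⊥-elim (succ-≮ t s t<s (subst (λ (u : Seg k) → proj₁ s < proj₁ u) e (<-succ s)))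

    decompose : ∀ s → ∃[ m ] ∃[ l ] fold l succ m ≡ s × (∀ w → ¬ succ w ≡ l)
    decompose = All.wfRec (On.wellFounded (λ (s : Seg k) → proj₁ s) wellFounded) 0ℓ
      (λ s → ∃[ m ] ∃[ l ] fold l succ m ≡ s × (∀ w → ¬ succ w ≡ l)) step
      where
      step : ∀ s → (∀ {t} → proj₁ t < proj₁ s → ∃[ m ] ∃[ l ] fold l succ m ≡ t × (∀ w → ¬ succ w ≡ l)) →
             ∃[ m ] ∃[ l ] fold l succ m ≡ s × (∀ w → ¬ succ w ≡ l)
      step s rec with em {∃[ w ] succ w ≡ s}
      ... | no ¬p = 0 , s , refl , λ w e → ¬p (w , e)
      ... | yes (w , refl) with rec {w} (<-succ w)
      ...   | m , l , e , l∉ = suc m , l , cong succ e , l∉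

    Seg×ℕ↣Seg : (Seg k × ℕ) ↣ Seg k
    Seg×ℕ↣Seg = absorb-ℕ succ succ-injective decompose

  module _ (ℕ≺κ : ℕ ≺κ) where

    absorb-⊎ℕ : ∀ {S : Set} → S × ℕ ≺κ → (S × ℕ) ⊎ ℕ ≺κ
    absorb-⊎ℕ {S} p with em {S}
    ... | yes s₀ = ≺κ-↣ (mk↣ inj) p
      where
      to : (S × ℕ) ⊎ ℕ → S × ℕ
      to (inj₁ (s , n)) = s , pair (0 , n)
      to (inj₂ n) = s₀ , pair (1 , n)

      inj : ∀ {x y} → to x ≡ to y → x ≡ y
      inj {inj₁ (s , m)} {inj₁ (t , n)} e with cong proj₁ e | pair-injective (0 , m) (0 , n) (cong proj₂ e)
      ... | refl | refl = refl
      inj {inj₁ (_ , m)} {inj₂ n} e with pair-injective (0 , m) (1 , n) (cong proj₂ e)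
      ... | ()
      inj {inj₂ m} {inj₁ (_ , n)} e with pair-injective (1 , m) (0 , n) (cong proj₂ e)
      ... | ()
      inj {inj₂ m} {inj₂ n} e with pair-injective (1 , m) (1 , n) (cong proj₂ e)
      ... | refl = refl
    ... | no ¬s = ≺κ-↣ (mk↣ inj) ℕ≺κ
      where
      to : (S × ℕ) ⊎ ℕ → ℕ
      to (inj₁ (s , _)) = ⊥-elim (¬s s)
      to (inj₂ n) = n

      inj : ∀ {x y} → to x ≡ to y → x ≡ y
      inj {inj₁ (s , _)} _ = ⊥-elim (¬s s)
      inj {inj₂ _} {inj₁ (s , _)} _ = ⊥-elim (¬s s)
      inj {inj₂ _} {inj₂ _} e = cong inj₂ e

    -- A segment without maximum, the empty one included, absorbs `ℕ` by itself; a maximum `j` adds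
    -- one copy of `ℕ` to `Seg j × ℕ`, where the induction hypothesis applies.
    Seg×ℕ-≺κ : ∀ k → Seg k × ℕ ≺κ
    Seg×ℕ-≺κ = All.wfRec wellFounded _ (λ k → Seg k × ℕ ≺κ) step
      where
      step : ∀ k → (∀ {j} → j < k → Seg j × ℕ ≺κ) → Seg k × ℕ ≺κ
      step k rec with em {∃[ j ] j < k × (∀ i → j < i → ¬ i < k)}
      ... | no no-max = ≺κ-↣ (Limit.Seg×ℕ↣Seg k unbounded) (Seg-≺κ k)
        where
        unbounded : ∀ j → j < k → ∃[ i ] j < i × i < k
        unbounded j j<k with em {∃[ i ] j < i × i < k}
        ... | yes p = p
        ... | no ¬p = ⊥-elim (no-max (j , j<k , λ i j<i i<k → ¬p (i , j<i , i<k)))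
      ... | yes (j , j<k , max) = ≺κ-↣ (mk↣ inj) (absorb-⊎ℕ (rec j<k))
        where
        to : Seg k × ℕ → (Seg j × ℕ) ⊎ ℕ
        to ((i , _) , n) with em {i < j}
        ... | yes i<j = inj₁ ((i , fromWitness i<j) , n)
        ... | no _ = inj₂ n

        top : ∀ {i} → True (em {i < k}) → ¬ i < j → i ≡ j
        top {i} i<k i≮j with compare i j
        ... | tri< i<j _ _ = ⊥-elim (i≮j i<j)
        ... | tri≈ _ i≡j _ = i≡j
        ... | tri> _ _ j<i = ⊥-elim (max i j<i (toWitness i<k))

        inj : ∀ {x y} → to x ≡ to y → x ≡ y
        inj {(i , p) , m} {(i′ , q) , n} e with em {i < j} | em {i′ < j}
        ... | yes _ | yes _ =
          cong₂ _,_ (Seg-≡ (cong (proj₁ ∘ proj₁) (inj₁-injective e))) (cong proj₂ (inj₁-injective e))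
        ... | no i≮j | no i′≮j =
          cong₂ _,_ (Seg-≡ (trans (top p i≮j) (sym (top q i′≮j)))) (inj₂-injective e)

    ×ℕ-≺κ : ∀ {S} → S ≺κ → S × ℕ ≺κ
    ×ℕ-≺κ {S} p with ≺κ⇒↣Seg p
    ... | k , f = ≺κ-↣ (mk↣ inj) (Seg×ℕ-≺κ k)
      where
      to : S × ℕ → Seg k × ℕ
      to (s , n) = Injection.to f s , n

      inj : ∀ {x y} → to x ≡ to y → x ≡ y
      inj {s , m} {t , n} e =
        cong₂ _,_ (Injection.injective f (cong proj₁ e)) (cong proj₂ e)

    Seg-mono : ∀ {j k} → j < k → Seg j ↣ Seg k
    Seg-mono j<k = segment (λ s → proj₁ s) Seg-≡ (λ s → <-trans (toWitness (proj₂ s)) j<k)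

    common-segment : ∀ {S T} → S ≺κ → T ≺κ → ∃[ k ] (S ↣ Seg k) × (T ↣ Seg k)
    common-segment p q with ≺κ⇒↣Seg p | ≺κ⇒↣Seg q
    ... | j , f | k , g with compare j k
    ... | tri< j<k _ _ = k , Composition.injection f (Seg-mono j<k) , g
    ... | tri≈ _ refl _ = k , f , g
    ... | tri> _ _ k<j = j , f , Composition.injection g (Seg-mono k<j)

    ⊎-≺κ : ∀ {S T} → S ≺κ → T ≺κ → S ⊎ T ≺κ
    ⊎-≺κ {S} {T} p q with common-segment p q
    ... | k , f , g = ≺κ-↣ (mk↣ inj) (Seg×ℕ-≺κ k)
      where
      to : S ⊎ T → Seg k × ℕ
      to (inj₁ s) = Injection.to f s , 0
      to (inj₂ t) = Injection.to g t , 1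

      inj : ∀ {x y} → to x ≡ to y → x ≡ y
      inj {inj₁ _} {inj₁ _} e = cong inj₁ (Injection.injective f (cong proj₁ e))
      inj {inj₁ _} {inj₂ _} e with cong proj₂ e
      ... | ()
      inj {inj₂ _} {inj₁ _} e with cong proj₂ e
      ... | ()
      inj {inj₂ _} {inj₂ _} e = cong inj₂ (Injection.injective g (cong proj₁ e))

open Equivalence using (to; from)

-- Formulas and compactness

module _ {L : Language} where
  open import Data.Vec using ([]; _∷_)

  mutual
    renameTerm : ∀ {m n} → (Fin m → Fin n) → Term L m → Term L n
    renameTerm r (var i)   = var (r i)
    renameTerm r (fn f ts) = fn f (renameTerms r ts)

    renameTerms : ∀ {m n k} → (Fin m → Fin n) → Vec (Term L m) k → Vec (Term L n) k
    renameTerms r []       = []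
    renameTerms r (t ∷ ts) = renameTerm r t ∷ renameTerms r ts

  rename : ∀ {m n} → (Fin m → Fin n) → Formula L m → Formula L n
  rename r falsum    = falsum
  rename r (s ≐ t)   = renameTerm r s ≐ renameTerm r t
  rename r (rl R ts) = rl R (renameTerms r ts)
  rename r (φ ⇒ ψ)   = rename r φ ⇒ rename r ψ
  rename r (all φ)   = all (rename (Fin.lift 1 r) φ)

  mapVars : ∀ {V W : Set} → (V → W) → FormulaIn L V → FormulaIn L W
  mapVars f (φ at vs) = φ at Vec.map f vs

  infixr 6 _⇛_
  _⇛_ : ∀ {V : Set} → FormulaIn L V → FormulaIn L V → FormulaIn L V
  _⇛_ (_at_ {m} φ vs) (_at_ {n} ψ ws) =
    (rename (_↑ˡ n) φ ⇒ rename (m ↑ʳ_) ψ) at (vs ++ ws)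

  false : ∀ {V : Set} → FormulaIn L V
  false = falsum at []

  infix 8 ∼_
  ∼_ : ∀ {V : Set} → FormulaIn L V → FormulaIn L V
  ∼ φ = φ ⇛ false

  true : ∀ {V : Set} → FormulaIn L V
  true = ∼ false

  infixr 7 _∧_
  _∧_ : ∀ {V : Set} → FormulaIn L V → FormulaIn L V → FormulaIn L V
  φ ∧ ψ = ∼ (φ ⇛ ∼ ψ)

  infixr 7 _∨_
  _∨_ : ∀ {V : Set} → FormulaIn L V → FormulaIn L V → FormulaIn L V
  φ ∨ ψ = ∼ φ ⇛ ψ

  equal : ∀ {V : Set} → V → V → FormulaIn L V
  equal v w = (var zero ≐ var (suc zero)) at (v ∷ w ∷ [])

module Logic (em : ExcludedMiddle 0ℓ) {L : Language} (𝔐 : Structure L) where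
  open Language L
  open Structure 𝔐 renaming (Carrier to M)
  open Semantics 𝔐
  open import Data.Vec using ([]; _∷_)

  mutual
    eval-rename : ∀ {m n} (r : Fin m → Fin n) {ρ ρ′} → (∀ i → lookup ρ′ (r i) ≡ lookup ρ i) →
                  ∀ t → eval ρ′ (renameTerm r t) ≡ eval ρ t
    eval-rename r h (var i)   = h i
    eval-rename r h (fn f ts) = cong (⟦fn⟧ f) (evals-rename r h ts)

    evals-rename : ∀ {m n k} (r : Fin m → Fin n) {ρ ρ′} → (∀ i → lookup ρ′ (r i) ≡ lookup ρ i) →
                   ∀ (ts : Vec (Term L m) k) → evals ρ′ (renameTerms r ts) ≡ evals ρ ts
    evals-rename r h []       = refl
    evals-rename r h (t ∷ ts) = cong₂ _∷_ (eval-rename r h t) (evals-rename r h ts)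

  lift-lookup : ∀ {m n} (r : Fin m → Fin n) {ρ : Vec M m} {ρ′ : Vec M n} {x} →
                (∀ i → lookup ρ′ (r i) ≡ lookup ρ i) →
                ∀ i → lookup (x ∷ ρ′) (Fin.lift 1 r i) ≡ lookup (x ∷ ρ) i
  lift-lookup r h zero    = refl
  lift-lookup r h (suc i) = h i

  Sat-rename : ∀ {m n} (r : Fin m → Fin n) {ρ ρ′} → (∀ i → lookup ρ′ (r i) ≡ lookup ρ i) →
               ∀ φ → Sat (rename r φ) ρ′ ⇔ Sat φ ρ
  Sat-rename r h falsum    = mk⇔ id id
  Sat-rename r h (s ≐ t)   =
    mk⇔ (λ e → trans (sym (eval-rename r h s)) (trans e (eval-rename r h t)))
        (λ e → trans (eval-rename r h s) (trans e (sym (eval-rename r h t))))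
  Sat-rename r h (rl R ts) =
    mk⇔ (subst (⟦rl⟧ R) (evals-rename r h ts)) (subst (⟦rl⟧ R) (sym (evals-rename r h ts)))
  Sat-rename r h (φ ⇒ ψ)   =
    mk⇔ (λ f x → to (Sat-rename r h ψ) (f (from (Sat-rename r h φ) x)))
        (λ f x → from (Sat-rename r h ψ) (f (to (Sat-rename r h φ) x)))
  Sat-rename r h (all φ)   =
    mk⇔ (λ f x → to (Sat-rename (Fin.lift 1 r) (lift-lookup r h) φ) (f x))
        (λ f x → from (Sat-rename (Fin.lift 1 r) (lift-lookup r h) φ) (f x))

  mutual
    eval-aut : ∀ σ {n} (ρ : Vec M n) t →
               eval (Vec.map (Automorphism.to σ) ρ) t ≡ Automorphism.to σ (eval ρ t)
    eval-aut σ ρ (var i)   = lookup-map i (Automorphism.to σ) ρ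
    eval-aut σ ρ (fn f ts) =
      trans (cong (⟦fn⟧ f) (evals-aut σ ρ ts)) (sym (Automorphism.preserves-fn σ f (evals ρ ts)))

    evals-aut : ∀ σ {n k} (ρ : Vec M n) (ts : Vec (Term L n) k) →
                evals (Vec.map (Automorphism.to σ) ρ) ts ≡ Vec.map (Automorphism.to σ) (evals ρ ts)
    evals-aut σ ρ []       = refl
    evals-aut σ ρ (t ∷ ts) = cong₂ _∷_ (eval-aut σ ρ t) (evals-aut σ ρ ts)

  Sat-aut : ∀ σ {n} (ρ : Vec M n) φ → Sat φ ρ ⇔ Sat φ (Vec.map (Automorphism.to σ) ρ)
  Sat-aut σ ρ falsum    = mk⇔ id id
  Sat-aut σ ρ (s ≐ t)   =
    mk⇔ (λ e → trans (eval-aut σ ρ s) (trans (cong (Automorphism.to σ) e) (sym (eval-aut σ ρ t))))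
        (λ e → Injective (trans (sym (eval-aut σ ρ s)) (trans e (eval-aut σ ρ t))))
    where
    Injective : ∀ {x y} → Automorphism.to σ x ≡ Automorphism.to σ y → x ≡ y
    Injective {x} {y} e = trans (sym (Inverse.strictlyInverseʳ (Automorphism.bijection σ) x))
      (trans (cong (Inverse.from (Automorphism.bijection σ)) e)
             (Inverse.strictlyInverseʳ (Automorphism.bijection σ) y))
  Sat-aut σ ρ (rl R ts) =
    mk⇔ (λ p → subst (⟦rl⟧ R) (sym (evals-aut σ ρ ts)) (to (Automorphism.preserves-rl σ R _) p))
        (λ p → from (Automorphism.preserves-rl σ R _) (subst (⟦rl⟧ R) (evals-aut σ ρ ts) p))
  Sat-aut σ ρ (φ ⇒ ψ)   =
    mk⇔ (λ f x → to (Sat-aut σ ρ ψ) (f (from (Sat-aut σ ρ φ) x)))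
        (λ f x → from (Sat-aut σ ρ ψ) (f (to (Sat-aut σ ρ φ) x)))
  Sat-aut σ ρ (all φ)   =
    mk⇔ (λ f x → subst (λ y → Sat φ (y ∷ Vec.map (Automorphism.to σ) ρ))
                   (Inverse.strictlyInverseˡ (Automorphism.bijection σ) x)
                   (to (Sat-aut σ _ φ) (f _)))
        (λ f x → from (Sat-aut σ (x ∷ ρ) φ) (f (Automorphism.to σ x)))

  module _ {V : Set} where

    ⊨-aut : ∀ σ {a : V → M} φ → a ⊨ φ ⇔ (Automorphism.to σ ∘ a) ⊨ φ
    ⊨-aut σ {a} (φ at vs) =
      mk⇔ (λ p → subst (Sat φ) (sym (map-∘ _ a vs)) (to (Sat-aut σ _ φ) p))
          (λ p → from (Sat-aut σ _ φ) (subst (Sat φ) (map-∘ _ a vs) p))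

    ⊨-local : ∀ {a b : V → M} φ → (∀ v → v ∈ᵛ FormulaIn.vars φ → a v ≡ b v) → a ⊨ φ → b ⊨ φ
    ⊨-local {a} {b} (φ at vs) h = subst (Sat φ) (map-local vs h)
      where
      map-local : ∀ {n} (vs : Vec V n) → (∀ v → v ∈ᵛ vs → a v ≡ b v) → Vec.map a vs ≡ Vec.map b vs
      map-local []       h = refl
      map-local (v ∷ vs) h = cong₂ _∷_ (h v (here refl)) (map-local vs (λ w → h w ∘ there))

    ⊨-⇛ : ∀ {a : V → M} φ ψ → a ⊨ φ ⇛ ψ ⇔ (a ⊨ φ → a ⊨ ψ)
    ⊨-⇛ {a} (_at_ {m} φ vs) (_at_ {n} ψ ws) =
      mk⇔ (λ f x → to right (f (from left x))) (λ f x → from right (f (to left x)))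
      where
      left : Sat (rename (_↑ˡ n) φ) (Vec.map a (vs ++ ws)) ⇔ Sat φ (Vec.map a vs)
      left = Sat-rename (_↑ˡ n) (λ i → trans (cong (λ l → lookup l (i ↑ˡ n)) (map-++ a vs ws))
        (lookup-++ˡ (Vec.map a vs) (Vec.map a ws) i)) φ

      right : Sat (rename (m ↑ʳ_) ψ) (Vec.map a (vs ++ ws)) ⇔ Sat ψ (Vec.map a ws)
      right = Sat-rename (m ↑ʳ_) (λ i → trans (cong (λ l → lookup l (m ↑ʳ i)) (map-++ a vs ws))
        (lookup-++ʳ (Vec.map a vs) (Vec.map a ws) i)) ψ

    ⊨-∼ : ∀ {a : V → M} φ → a ⊨ ∼ φ ⇔ (¬ a ⊨ φ)
    ⊨-∼ φ = ⊨-⇛ φ false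

    ⊨-true : ∀ {a : V → M} → a ⊨ true
    ⊨-true {a} = from (⊨-∼ {a} false) id

    ⊨-∧ : ∀ {a : V → M} φ ψ → a ⊨ φ ∧ ψ ⇔ (a ⊨ φ × a ⊨ ψ)
    ⊨-∧ {a} φ ψ = mk⇔ split
      (λ (x , y) → from (⊨-∼ (φ ⇛ ∼ ψ)) (λ f → to (⊨-∼ ψ) (to (⊨-⇛ φ (∼ ψ)) f x) y))
      where
      split : a ⊨ φ ∧ ψ → a ⊨ φ × a ⊨ ψ
      split p with em {a ⊨ φ × a ⊨ ψ}
      ... | yes q = q
      ... | no ¬q = ⊥-elim (to (⊨-∼ (φ ⇛ ∼ ψ)) p
                      (from (⊨-⇛ φ (∼ ψ)) (λ x → from (⊨-∼ ψ) (λ y → ¬q (x , y)))))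

    ⊨-∨ : ∀ {a : V → M} φ ψ → a ⊨ φ ∨ ψ ⇔ (a ⊨ φ ⊎ a ⊨ ψ)
    ⊨-∨ {a} φ ψ = mk⇔ split
      [ (λ x → from (⊨-⇛ (∼ φ) ψ) (λ f → ⊥-elim (to (⊨-∼ φ) f x)))
      , (λ y → from (⊨-⇛ (∼ φ) ψ) (const y)) ]′
      where
      split : a ⊨ φ ∨ ψ → a ⊨ φ ⊎ a ⊨ ψ
      split p with em {a ⊨ φ}
      ... | yes x = inj₁ x
      ... | no ¬x = inj₂ (to (⊨-⇛ (∼ φ) ψ) p (from (⊨-∼ φ) ¬x))

    ⊨-mapVars : ∀ {W : Set} (f : V → W) {a : W → M} φ → a ⊨ mapVars f φ ⇔ (a ∘ f) ⊨ φ
    ⊨-mapVars f {a} (φ at vs) =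
      mk⇔ (subst (Sat φ) (sym (map-∘ a f vs))) (subst (Sat φ) (map-∘ a f vs))

    infix 9 _[_≔_]
    _[_≔_] : (V → M) → V → M → V → M
    (a [ v ≔ m ]) w with em {w ≡ v}
    ... | yes _ = m
    ... | no _ = a w

    ≔-other : ∀ {a : V → M} {v m w} → ¬ w ≡ v → (a [ v ≔ m ]) w ≡ a w
    ≔-other {v = v} {w = w} w≢v with em {w ≡ v}
    ... | yes w≡v = ⊥-elim (w≢v w≡v)
    ... | no _ = refl

    -- Positions of `vs` holding `v` are redirected to the index being bound, so `vs` itself can
    -- stay as it is.
    bind : ∀ {n} → V → Vec V n → Fin n → Fin (suc n)
    bind v vs i with em {lookup vs i ≡ v}
    ... | yes _ = zero
    ... | no _ = suc i

    exists : V → FormulaIn L V → FormulaIn L V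
    exists v (φ at vs) = ∼ (all (rename (bind v vs) φ ⇒ falsum) at vs)

    ⊨-exists : ∀ {a : V → M} v φ → a ⊨ exists v φ ⇔ (∃[ m ] (a [ v ≔ m ]) ⊨ φ)
    ⊨-exists {a} v (_at_ {n} φ vs) = mk⇔ find
      (λ (m , p) → from (⊨-∼ (all (rename (bind v vs) φ ⇒ falsum) at vs)) (λ f → f m (from (bound m) p)))
      where
      bound : ∀ m → Sat (rename (bind v vs) φ) (m ∷ Vec.map a vs) ⇔ (a [ v ≔ m ]) ⊨ (φ at vs)
      bound m = Sat-rename (bind v vs) agree φ
        where
        agree : ∀ i → lookup (m ∷ Vec.map a vs) (bind v vs i) ≡ lookup (Vec.map (a [ v ≔ m ]) vs) i
        agree i rewrite lookup-map i (a [ v ≔ m ]) vs with em {lookup vs i ≡ v}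
        ... | yes _ = refl
        ... | no _ = lookup-map i a vs

      find : a ⊨ exists v (φ at vs) → ∃[ m ] (a [ v ≔ m ]) ⊨ (φ at vs)
      find p with em {∃[ m ] (a [ v ≔ m ]) ⊨ (φ at vs)}
      ... | yes q = q
      ... | no ¬q = ⊥-elim (to (⊨-∼ (all (rename (bind v vs) φ ⇒ falsum) at vs)) p
                      (λ m x → ¬q (m , to (bound m) x)))

    splice : (V → Set) → (V → M) → (V → M) → V → M
    splice U a b v with em {U v}
    ... | yes _ = a v
    ... | no _ = b v

    splice-in : ∀ {U a b v} → U v → splice U a b v ≡ a v
    splice-in {U} {v = v} u with em {U v}
    ... | yes _ = refl
    ... | no ¬u = ⊥-elim (¬u u)

    splice-out : ∀ {U a b v} → ¬ U v → splice U a b v ≡ b v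
    splice-out {U} {v = v} ¬u with em {U v}
    ... | yes u = ⊥-elim (¬u u)
    ... | no _ = refl

    module _ (U : V → Set) where

      -- The complement of `U` may be infinite, but a formula needs quantifiers only for its own
      -- finitely many variables. Entries of `vs` outside `U` are quantified; the disjunction lists
      -- the variables that keep their value.
      eliminate-vars : ∀ {n} (vs : Vec V n) φ → ∃[ ψ ] (∀ (a : V → M) →
        a ⊨ ψ ⇔ (∃[ b ] b ⊨ φ × (∀ v → U v ⊎ ¬ v ∈ᵛ vs → b v ≡ a v)))
      eliminate-vars [] φ = φ , λ a →
        mk⇔ (λ p → a , p , λ _ _ → refl)
            (λ (b , p , b≗a) → ⊨-local φ (λ v _ → b≗a v (inj₂ λ ())) p)
      eliminate-vars (w ∷ vs) φ with eliminate-vars vs φ | em {U w}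
      ... | ψ , h | yes Uw = ψ , λ a →
        mk⇔ (λ p → let b , q , e = to (h a) p in
               b , q , λ v → [ e v ∘ inj₁ , (λ v∉ → e v (inj₂ (v∉ ∘ there))) ]′)
            (λ (b , q , e) → from (h a) (b , q , λ v → [ e v ∘ inj₁ , outside e ]′))
        where
        outside : ∀ {a b : V → M} {v} → (∀ v → U v ⊎ ¬ v ∈ᵛ (w ∷ vs) → b v ≡ a v) →
                  ¬ v ∈ᵛ vs → b v ≡ a v
        outside {v = v} e v∉ with em {v ≡ w}
        ... | yes refl = e v (inj₁ Uw)
        ... | no v≢w = e v (inj₂ λ { (here v≡w) → v≢w v≡w ; (there v∈) → v∉ v∈ })
      ... | ψ , h | no ¬Uw = exists w ψ , λ a →
        mk⇔ (λ p → let m , q = to (⊨-exists w ψ) p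
                       b , r , e = to (h _) q
                   in b , r , λ v c → trans (e v (widen c)) (≔-other (fresh c)))
            (λ (b , r , e) → from (⊨-exists w ψ) (b w , from (h _) (b , r , agree e)))
        where
        widen : ∀ {v} → U v ⊎ ¬ v ∈ᵛ (w ∷ vs) → U v ⊎ ¬ v ∈ᵛ vs
        widen (inj₁ u) = inj₁ u
        widen (inj₂ v∉) = inj₂ (v∉ ∘ there)

        fresh : ∀ {v} → U v ⊎ ¬ v ∈ᵛ (w ∷ vs) → ¬ v ≡ w
        fresh (inj₁ Uv) refl = ¬Uw Uv
        fresh (inj₂ v∉) v≡w = v∉ (here v≡w)

        agree : ∀ {a b : V → M} → (∀ v → U v ⊎ ¬ v ∈ᵛ (w ∷ vs) → b v ≡ a v) →
                ∀ v → U v ⊎ ¬ v ∈ᵛ vs → b v ≡ (a [ w ≔ b w ]) v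
        agree {a} {b} e v c with em {v ≡ w}
        ... | yes refl = refl
        ... | no v≢w with c
        ...   | inj₁ u = e v (inj₁ u)
        ...   | inj₂ v∉ = e v (inj₂ λ { (here v≡w) → v≢w v≡w ; (there v∈) → v∉ v∈ })

      eliminate : ∀ φ → ∃[ ψ ] (∀ (a : V → M) →
        a ⊨ ψ ⇔ (∃[ b ] b ⊨ φ × (∀ v → U v → b v ≡ a v)))
      eliminate φ with eliminate-vars (FormulaIn.vars φ) φ
      ... | ψ , h = ψ , λ a →
        mk⇔ (λ p → let b , q , e = to (h a) p in b , q , λ v u → e v (inj₁ u))
            (λ (b , q , e) → from (h a)
              -- `b` is arbitrary outside `U`; resetting it to `a` off the variables of `φ` gives
              -- the agreement that `eliminate-vars` demands.
              ( splice (_∈ᵛ FormulaIn.vars φ) b a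
              , ⊨-local φ (λ v v∈ → sym (splice-in v∈)) q
              , λ v → [ same e , splice-out ]′))
        where
        same : ∀ {a b : V → M} {v} → (∀ v → U v → b v ≡ a v) → U v →
               splice (_∈ᵛ FormulaIn.vars φ) b a v ≡ a v
        same {v = v} e u with em {v ∈ᵛ FormulaIn.vars φ}
        ... | yes _ = e v u
        ... | no _ = refl

  -- Compactness for assignments to fewer than κ variables

  open import Data.List using ([]; _∷_)
  open import Data.List.Relation.Unary.All using ([]; _∷_)

  -- Saturation asks about finite lists of formulas. In a directed set a single member can stand in
  -- for a list, because `Q` passes to stronger formulas.
  directed-lower-bound :
    ∀ {V : Set} (p : Pred (FormulaIn L V) 0ℓ) → ∃[ φ ] p φ →
    (∀ φ ψ → p φ → p ψ → ∃[ χ ] p χ × (∀ a → a ⊨ χ → a ⊨ φ × a ⊨ ψ)) →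
    {A : Set} (Q : FormulaIn L V → A → Set) → (∀ {φ χ x} → (∀ a → a ⊨ χ → a ⊨ φ) → Q φ x → Q χ x) →
    ∀ xs → ListAll.All (λ x → ∃[ φ ] p φ × Q φ x) xs → ∃[ φ ] p φ × ListAll.All (Q φ) xs
  directed-lower-bound p (φ₀ , pφ₀) directed Q mono [] [] = φ₀ , pφ₀ , []
  directed-lower-bound p inhabited directed Q mono (x ∷ xs) ((φ , pφ , q) ∷ qs)
    with directed-lower-bound p inhabited directed Q mono xs qs
  ... | ψ , pψ , qs′ with directed φ ψ pφ pψ
  ...   | χ , pχ , χ⇒ = χ , pχ , mono (λ a → proj₁ ∘ χ⇒ a) q ∷ weaken qs′
    where
    weaken : ∀ {ys} → ListAll.All (Q ψ) ys → ListAll.All (Q χ) ys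
    weaken [] = []
    weaken (r ∷ rs) = mono (λ a → proj₂ ∘ χ⇒ a) r ∷ weaken rs

  module _ (ext : Extensionality 0ℓ 0ℓ) (κ : Cardinal) (saturated : Saturated κ) where
    open Cardinal κ renaming (Carrier to K)
    open IsStrictTotalOrder isStrictTotalOrder using (compare) renaming (trans to <-trans)

    -- Values are chosen along a well-ordering of V, keeping p finitely
    -- satisfiable by assignments that extend the choices made so far.
    module Compactness
      {V : Set} (V≺κ : setoid V ≺ κ) (p : Pred (FormulaIn L V) 0ℓ)
      (directed : ∀ φ ψ → p φ → p ψ → ∃[ χ ] p χ × (∀ a → a ⊨ χ → a ⊨ φ × a ⊨ ψ))
      (inhabited : ∃[ φ ] p φ)
      (satisfiable : ∀ φ → p φ → ∃[ a ] a ⊨ φ)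
      where

      ι : V → K
      ι = Injection.to (proj₁ V≺κ)

      infix 4 _⊏_
      _⊏_ : V → V → Set
      v ⊏ w = ι v < ι w

      ⊏-wellFounded : WellFounded _⊏_
      ⊏-wellFounded = On.wellFounded ι wellFounded

      ⊏-irrefl : ∀ {v} → ¬ v ⊏ v
      ⊏-irrefl v⊏v = wf⇒asym wellFounded v⊏v v⊏v

      Extends : V → (V → M) → M → Set
      Extends v f x = ∀ φ → p φ → ∃[ a ] a ⊨ φ × (∀ w → w ⊏ v → a w ≡ f w) × a v ≡ x

      Extends-local : ∀ {v f g x} → (∀ w → w ⊏ v → f w ≡ g w) → Extends v f x → Extends v g x
      Extends-local f≗g e φ pφ =
        let a , a⊨φ , a≗f , av = e φ pφ in a , a⊨φ , (λ w w⊏v → trans (a≗f w w⊏v) (f≗g w w⊏v)) , av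

      choice : Σ[ m ∈ (V → M) ] (∀ v → (∃[ x ] Extends v m x) → Extends v m (m v))
      choice = wf-choice em ext ⊏-wellFounded
        (proj₁ (satisfiable (proj₁ inhabited) (proj₂ inhabited))) Extends Extends-local

      m : V → M
      m = proj₁ choice

      AgreeBelow : V → Set
      AgreeBelow v = ∀ φ → p φ → ∃[ a ] a ⊨ φ × (∀ w → w ⊏ v → a w ≡ m w)

      module _ (v : V) (below : AgreeBelow v) where

        Kept : V → Set
        Kept w = w ⊏ v ⊎ w ≡ v

        -- One-variable saturation sees `v` as its variable and all others as parameters with values
        -- `m`. Variables after `v` are first quantified away by `eliminate Kept`.
        name : V → ⊤ ⊎ V
        name w with em {w ≡ v}
        ... | yes _ = inj₁ tt
        ... | no _ = inj₂ w

        name-value : ∀ {x} {a : V → M} → (∀ w → w ⊏ v → a w ≡ m w) → a v ≡ x →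
                     ∀ w → Kept w → a w ≡ [ const x , m ]′ (name w)
        name-value a≗m av w k with em {w ≡ v}
        ... | yes refl = av
        name-value a≗m av w (inj₁ w⊏v) | no _ = a≗m w w⊏v
        name-value a≗m av w (inj₂ w≡v) | no w≢v = ⊥-elim (w≢v w≡v)

        value-name : ∀ {x} {a : V → M} → (∀ w → Kept w → a w ≡ [ const x , m ]′ (name w)) →
                     (∀ w → w ⊏ v → a w ≡ m w) × a v ≡ x
        value-name {x} {a} e = (λ w w⊏v → trans (e w (inj₁ w⊏v)) (old w w⊏v)) , trans (e v (inj₂ refl)) new
          where
          old : ∀ w → w ⊏ v → [ const x , m ]′ (name w) ≡ m w
          old w w⊏v with em {w ≡ v}
          ... | yes refl = ⊥-elim (⊏-irrefl w⊏v)
          ... | no _ = refl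

          new : [ const x , m ]′ (name v) ≡ x
          new with em {v ≡ v}
          ... | yes _ = refl
          ... | no v≢v = ⊥-elim (v≢v refl)

        Forces : FormulaIn L V → FormulaIn L (⊤ ⊎ V) → Set
        Forces φ χ = ∀ a → a ⊨ φ → (∀ w → w ⊏ v → a w ≡ m w) → [ const (a v) , m ]′ ⊨ χ

        -- All that a member of `p` implies about the value at `v` once the earlier values are
        -- fixed. In particular `q` contains each member of `p` with its later variables quantified.
        q : Pred (FormulaIn L (⊤ ⊎ V)) 0ℓ
        q χ = ∃[ φ ] p φ × Forces φ χ

        q-satisfiable : (χs : List (FormulaIn L (⊤ ⊎ V))) → ListAll.All q χs →
                        ∃[ x ] ListAll.All ([ const x , m ]′ ⊨_) χs
        q-satisfiable χs qs
          with directed-lower-bound p inhabited directed Forces (λ χ⇒φ f a a⊨χ → f a (χ⇒φ a a⊨χ)) χs qs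
        ... | φ , pφ , fs = let a , a⊨φ , a≗m = below φ pφ in a v , collect a a⊨φ a≗m fs
          where
          collect : ∀ a → a ⊨ φ → (∀ w → w ⊏ v → a w ≡ m w) → ∀ {χs} → ListAll.All (Forces φ) χs →
                    ListAll.All ([ const (a v) , m ]′ ⊨_) χs
          collect a a⊨φ a≗m [] = []
          collect a a⊨φ a≗m (f ∷ fs) = f a a⊨φ a≗m ∷ collect a a⊨φ a≗m fs

        extend : ∃[ x ] Extends v m x
        extend with saturated V V≺κ m q q-satisfiable
        ... | x , realises = x , extends
          where
          extends : Extends v m x
          extends φ pφ with eliminate Kept φ
          ... | ψ , h = a , a⊨φ , value-name e
            where
            forced : Forces φ (mapVars name ψ)
            forced b b⊨φ b≗m = from (⊨-mapVars name ψ)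
              (from (h _) (b , b⊨φ , name-value {a = b} b≗m refl))

            witness : ∃[ a ] a ⊨ φ × (∀ w → Kept w → a w ≡ [ const x , m ]′ (name w))
            witness = to (h _) (to (⊨-mapVars name ψ)
              (realises (mapVars name ψ) (φ , pφ , forced)))

            a = proj₁ witness
            a⊨φ = proj₁ (proj₂ witness)
            e = proj₂ (proj₂ witness)

      maximal : (U : V → Set) → ∀ {n} (vs : Vec V n) →
                (∀ v → v ∈ᵛ vs → ¬ U v) ⊎
                (∃[ w ] U w × (∀ v → v ∈ᵛ vs → U v → v ⊏ w ⊎ v ≡ w))
      maximal U [] = inj₁ λ _ ()
      maximal U (v ∷ vs) with maximal U vs | em {U v}
      ... | inj₁ none | no ¬u = inj₁ λ { _ (here refl) → ¬u ; w (there w∈) → none w w∈ }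
      ... | inj₁ none | yes u = inj₂ (v , u , λ
        { _ (here refl) _ → inj₂ refl ; w (there w∈) u′ → ⊥-elim (none w w∈ u′) })
      ... | inj₂ (w , u , max) | no ¬u = inj₂ (w , u , λ
        { _ (here refl) u′ → ⊥-elim (¬u u′) ; x (there x∈) → max x x∈ })
      ... | inj₂ (w , u , max) | yes u′ with compare (ι v) (ι w)
      ...   | tri< v⊏w _ _ = inj₂ (w , u , λ
        { _ (here refl) _ → inj₁ v⊏w ; x (there x∈) → max x x∈ })
      ...   | tri≈ _ v≡w _ = inj₂ (w , u , λ
        { _ (here refl) _ → inj₂ (Injection.injective (proj₁ V≺κ) v≡w) ; x (there x∈) → max x x∈ })
      ...   | tri> _ _ w⊏v = inj₂ (v , u′ , λ
        { _ (here refl) _ → inj₂ refl ; x (there x∈) u″ → inj₁ (above (max x x∈ u″)) })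
        where
        above : ∀ {x} → x ⊏ w ⊎ x ≡ w → x ⊏ v
        above (inj₁ x⊏w) = <-trans x⊏w w⊏v
        above (inj₂ refl) = w⊏v

      -- Agreement with `m` up to the ⊏-largest variable of `φ` in `U` is enough; the rest of `m` on
      -- `U` can be copied in without affecting `φ`. This settles limit stages and, with `U`
      -- everything, the final assignment.
      agree-on : (U : V → Set) → (∀ v → U v → Extends v m (m v)) →
                 ∀ φ → p φ → ∃[ a ] a ⊨ φ × (∀ v → U v → a v ≡ m v)
      agree-on U good φ pφ with maximal U (FormulaIn.vars φ)
      ... | inj₁ none = let a , a⊨φ = satisfiable φ pφ in
        splice U m a ,
        ⊨-local φ (λ v v∈ → sym (splice-out {a = m} (none v v∈))) a⊨φ ,
        λ v → splice-in {b = a}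
      ... | inj₂ (w , u , max) = let a , a⊨φ , a≗m , aw = good w u φ pφ in
        splice U m a , ⊨-local φ (λ v v∈ → unchanged a a≗m aw v v∈) a⊨φ , λ v → splice-in {b = a}
        where
        unchanged : ∀ a → (∀ v → v ⊏ w → a v ≡ m v) → a w ≡ m w →
                    ∀ v → v ∈ᵛ FormulaIn.vars φ → a v ≡ splice U m a v
        unchanged a a≗m aw v v∈ with em {U v}
        ... | no _ = refl
        ... | yes Uv with max v v∈ Uv
        ...   | inj₁ v⊏w = a≗m v v⊏w
        ...   | inj₂ refl = aw

      extends : ∀ v → Extends v m (m v)
      extends = All.wfRec ⊏-wellFounded 0ℓ (λ v → Extends v m (m v))
        λ v rec → proj₂ choice v (extend v (agree-on (_⊏ v) (λ w → rec)))

      compactness : ∃[ a ] (∀ φ → p φ → a ⊨ φ)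
      compactness = m , λ φ pφ → let a , a⊨φ , a≗m = agree-on (λ _ → ⊤) (λ v _ → extends v) φ pφ in
        ⊨-local φ (λ v _ → a≗m v tt) a⊨φ

open import Data.Vec.Functional using ([]; _∷_)

-- Left-invariant equivalence relations on the automorphism group

module Conjugacies (G : Group 0ℓ 0ℓ) where
  open Group G using (_∙_; ε; _⁻¹; identityˡ; identityʳ; inverseˡ; assoc)
    renaming (Carrier to Aut; _≈_ to _≗_; refl to ≗-refl; sym to ≗-sym; trans to ≗-trans; ∙-cong to ≗-cong)

  -- For a tuple a of hyperimaginaries, the relation αa = βa on automorphisms.
  record Conjugacy : Set₁ where
    infix 4 _≈_
    field
      _≈_             : Rel Aut 0ℓ
      ≈-isEquivalence : IsEquivalence _≈_
      left            : ∀ γ {α β} → α ≈ β → γ ∙ α ≈ γ ∙ β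
      reflexive       : ∀ {α β} → α ≗ β → α ≈ β

    open IsEquivalence ≈-isEquivalence public
      using () renaming (refl to ≈-refl; sym to ≈-sym; trans to ≈-trans)

    undo-right : ∀ γ τ → (τ ∙ γ ⁻¹) ∙ γ ≈ τ
    undo-right γ τ = reflexive (≗-trans (assoc _ _ _) (≗-trans (≗-cong ≗-refl (inverseˡ γ)) (identityʳ τ)))

    to-identity : ∀ γ {δ} → γ ≈ δ → δ ⁻¹ ∙ γ ≈ ε
    to-identity γ {δ} e = ≈-trans (left (δ ⁻¹) e) (reflexive (inverseˡ δ))

    from-identity : ∀ γ δ → δ ⁻¹ ∙ γ ≈ ε → γ ≈ δ
    from-identity γ δ e = ≈-trans (≈-sym redo) (≈-trans (left δ e) (reflexive (identityʳ δ)))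
      where
      redo : δ ∙ (δ ⁻¹ ∙ γ) ≈ γ
      redo = reflexive (≗-trans (≗-sym (assoc _ _ _)) (≗-trans (≗-cong (inverseʳ δ) ≗-refl) (identityˡ γ)))
        where open Group G using (inverseʳ)

  -- One ρ acts as τ₁ on γa and δa and as τ₂ on εb and ζb.
  Orthogonal : Conjugacy → Conjugacy → Set
  Orthogonal A B = ∀ τ₁ γ δ τ₂ ε ζ → ∃[ ρ ]
    (ρ ∙ γ ≈ᵃ τ₁ ∙ γ × ρ ∙ δ ≈ᵃ τ₁ ∙ δ) ×
    (ρ ∙ ε ≈ᵇ τ₂ ∙ ε × ρ ∙ ζ ≈ᵇ τ₂ ∙ ζ)
    where
    open Conjugacy A renaming (_≈_ to _≈ᵃ_)
    open Conjugacy B renaming (_≈_ to _≈ᵇ_)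

  -- z ∈ dcl(ab).
  Determines : Conjugacy → Conjugacy → Conjugacy → Set
  Determines A B Z = ∀ γ δ → γ ≈ᵃ δ → γ ≈ᵇ δ → γ ≈ᶻ δ
    where
    open Conjugacy A renaming (_≈_ to _≈ᵃ_)
    open Conjugacy B renaming (_≈_ to _≈ᵇ_)
    open Conjugacy Z renaming (_≈_ to _≈ᶻ_)

  -- Writing z = f(a , b): the relation f(αa , b′) = f(βa , b′), for one or
  -- equivalently every conjugate b′ of b.
  module Fibre (A B Z : Conjugacy) (orth : Orthogonal A B) (det : Determines A B Z) where
    private
      module A = Conjugacy A
      module B = Conjugacy B
      module Z = Conjugacy Z

    infix 4 _≈ᶠ_
    _≈ᶠ_ : Rel Aut 0ℓ
    α ≈ᶠ β = ∃[ γ ] ∃[ δ ] γ A.≈ α × δ A.≈ β × γ B.≈ δ × γ Z.≈ δ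

    -- By orthogonality some `ρ` fixes γa and δa and carries γb to τb, so a witness over one
    -- conjugate of b moves to any other.
    normalise : ∀ {α β} → α ≈ᶠ β → ∀ τ →
                ∃[ γ ] ∃[ δ ] γ A.≈ α × δ A.≈ β × γ B.≈ τ × δ B.≈ τ × γ Z.≈ δ
    normalise (γ , δ , γα , δβ , γδ , zγδ) τ
      with orth ε γ δ (τ ∙ γ ⁻¹) γ γ
    ... | ρ , (ργ , ρδ) , (ργ′ , _) = ρ ∙ γ , ρ ∙ δ ,
      A.≈-trans (A.≈-trans ργ (A.reflexive (identityˡ _))) γα ,
      A.≈-trans (A.≈-trans ρδ (A.reflexive (identityˡ _))) δβ ,
      ργ≈τ , B.≈-trans (B.left ρ (B.≈-sym γδ)) ργ≈τ ,
      Z.left ρ zγδ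
      where
      ργ≈τ : ρ ∙ γ B.≈ τ
      ργ≈τ = B.≈-trans ργ′ (B.undo-right γ τ)

    ≈ᶠ-of-≈ : ∀ {α β} → α A.≈ β → α ≈ᶠ β
    ≈ᶠ-of-≈ {α} e = α , α , A.≈-refl , e , B.≈-refl , Z.≈-refl

    ≈ᶠ-resp : ∀ {α α′ β β′} → α A.≈ α′ → β A.≈ β′ → α ≈ᶠ β → α′ ≈ᶠ β′
    ≈ᶠ-resp e e′ (γ , δ , γα , δβ , rest) = γ , δ , A.≈-trans γα e , A.≈-trans δβ e′ , rest

    ≈ᶠ-sym : ∀ {α β} → α ≈ᶠ β → β ≈ᶠ α
    ≈ᶠ-sym (γ , δ , γα , δβ , γδ , zγδ) = δ , γ , δβ , γα , B.≈-sym γδ , Z.≈-sym zγδ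

    ≈ᶠ-trans : ∀ {α β ε} → α ≈ᶠ β → β ≈ᶠ ε → α ≈ᶠ ε
    -- Here `ε` is the identity, so both witnesses are placed over b itself. Then δ and γ′ agree on
    -- a and on b, hence on z, and the two equalities can be chained.
    ≈ᶠ-trans p q with normalise p ε | normalise q ε
    ... | γ , δ , γα , δβ , γ1 , δ1 , zγδ | γ′ , δ′ , γ′β , δ′ε , γ′1 , δ′1 , zγ′δ′ =
      γ , δ′ , γα , δ′ε , B.≈-trans γ1 (B.≈-sym δ′1) ,
      Z.≈-trans zγδ (Z.≈-trans
        (det δ γ′ (A.≈-trans δβ (A.≈-sym γ′β)) (B.≈-trans δ1 (B.≈-sym γ′1))) zγ′δ′)

    -- Let ρ act as τ on a and σa and trivially on b and σb.  Then ρ fixes x and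
    -- y, hence z, so f(ρσa , σb) = z = f(σa , σb) and τσx = ρσx = σx.
    fixed-conjugate :
      (X Y : Conjugacy) → (∀ α β → α ≈ᶠ β → Conjugacy._≈_ X α β) →
      (∀ α β → α B.≈ β → Conjugacy._≈_ Y α β) → Determines X Y Z →
      ∀ σ τ → σ Z.≈ ε → Conjugacy._≈_ X τ ε → Conjugacy._≈_ X (τ ∙ σ) σ
    fixed-conjugate X Y fibre⇒x b⇒y xy⇒z σ τ σz τx with orth τ ε σ ε ε σ
    ... | ρ , (ρa , ρσa) , (ρb , ρσb) =
      X.≈-trans (X.≈-sym (a⇒x ρσa)) (fibre⇒x (ρ ∙ σ) σ
        (ρ ∙ σ , σ , A.≈-refl , A.≈-refl , B.≈-trans ρσb (B.reflexive (identityˡ σ)) ,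
         Z.≈-trans (Z.left ρ σz) (Z.≈-trans ρεz (Z.≈-sym σz))))
      where
      module X = Conjugacy X
      module Y = Conjugacy Y

      a⇒x : ∀ {α β} → α A.≈ β → α X.≈ β
      a⇒x e = fibre⇒x _ _ (≈ᶠ-of-≈ e)

      ρεz : ρ ∙ ε Z.≈ ε
      ρεz = xy⇒z (ρ ∙ ε) ε
        (X.≈-trans (a⇒x ρa) (X.≈-trans (X.reflexive (identityʳ τ)) τx))
        (b⇒y (ρ ∙ ε) ε (B.≈-trans ρb (B.reflexive (identityˡ ε))))

  Orthogonal-sym : ∀ {A B} → Orthogonal A B → Orthogonal B A
  Orthogonal-sym orth τ₁ γ δ τ₂ ε ζ with orth τ₂ ε ζ τ₁ γ δ
  ... | ρ , p , q = ρ , q , p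

  module Rectangle (A B Z : Conjugacy) (orth : Orthogonal A B) (det : Determines A B Z) where
    private
      module A = Conjugacy A
      module B = Conjugacy B
      module Z = Conjugacy Z
      module FA = Fibre A B Z orth det
      module FB = Fibre B A Z (Orthogonal-sym {A} {B} orth) (λ γ δ b a → det γ δ a b)

    -- f(αa , αb) = f(βa , αb) = f(βa , βb).
    corners : ∀ {α β} → α FA.≈ᶠ β → α FB.≈ᶠ β → α Z.≈ β
    corners {α} {β} p q with FA.normalise p α | FB.normalise q β
    ... | γ , δ , γα , δβ , γbα , δbα , zγδ | γ′ , δ′ , γ′α , δ′β , γ′aβ , δ′aβ , zγ′δ′ =
      Z.≈-trans (det α γ (A.≈-sym γα) (B.≈-sym γbα))
      (Z.≈-trans zγδ
      (Z.≈-trans (det δ γ′ (A.≈-trans δβ (A.≈-sym γ′aβ)) (B.≈-trans δbα (B.≈-sym γ′α)))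
      (Z.≈-trans zγ′δ′ (det δ′ β δ′aβ δ′β))))

-- Type-definable sets and hyperimaginaries

module Model (em : ExcludedMiddle 0ℓ) (ext : Extensionality 0ℓ 0ℓ) (𝕄 : MonsterModel) where
  open MonsterModel 𝕄
  open Structure 𝔐 renaming (Carrier to M) using ()
  open Hyperimaginaries 𝕄
  open Logic em 𝔐
  open Cardinals em ext κ

  -- Singletons embed `ℕ` into the sets of formulas, which `large` bounds; the atoms differ only in
  -- the variable listed.
  ℕ≺κ : ℕ ≺κ
  ℕ≺κ = ≺κ-↣ (mk↣ inj) large
    where
    atom : ℕ → FormulaIn L ℕ
    atom n = falsum at (n Vec.∷ Vec.[])

    inj : ∀ {m n} → (λ φ → does (em {φ ≡ atom m})) ≡ (λ φ → does (em {φ ≡ atom n})) → m ≡ n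
    inj {m} {n} e with em {atom m ≡ atom m} | em {atom m ≡ atom n} | cong (λ f → f (atom m)) e
    ... | yes _ | yes refl | _ = refl
    ... | no ¬refl | _ | _ = ⊥-elim (¬refl refl)

  _·ᵃ_ : ∀ {V : Set} → Automorphism → (V → M) → V → M
  σ ·ᵃ a = Automorphism.to σ ∘ a

  idᴬ : Automorphism
  idᴬ = record
    { bijection = Identity.↔-id M
    ; preserves-fn = λ f ms → cong (Structure.⟦fn⟧ 𝔐 f) (sym (map-id ms))
    ; preserves-rl = λ r ms → mk⇔ (subst (Structure.⟦rl⟧ 𝔐 r) (sym (map-id ms)))
                                  (subst (Structure.⟦rl⟧ 𝔐 r) (map-id ms))
    }

  infixr 9 _∘ᴬ_
  _∘ᴬ_ : Automorphism → Automorphism → Automorphism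
  σ ∘ᴬ τ = record
    { bijection = Composition.inverse (bijection τ) (bijection σ)
    ; preserves-fn = λ f ms → trans (cong (app σ) (preserves-fn τ f ms))
        (trans (preserves-fn σ f (Vec.map (app τ) ms))
          (cong (Structure.⟦fn⟧ 𝔐 f) (sym (map-∘ (app σ) (app τ) ms))))
    ; preserves-rl = λ r ms → mk⇔
        (λ p → subst (Structure.⟦rl⟧ 𝔐 r) (sym (map-∘ (app σ) (app τ) ms))
          (to (preserves-rl σ r _) (to (preserves-rl τ r ms) p)))
        (λ p → from (preserves-rl τ r ms) (from (preserves-rl σ r _)
          (subst (Structure.⟦rl⟧ 𝔐 r) (map-∘ (app σ) (app τ) ms) p)))
    }
    where open Automorphism renaming (to to app)

  infix 10 _⁻¹
  _⁻¹ : Automorphism → Automorphism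
  σ ⁻¹ = record
    { bijection = Symmetry.inverse bijection
    ; preserves-fn = λ f ms → trans
        (cong (λ ns → undo (Structure.⟦fn⟧ 𝔐 f ns)) (sym (redo ms)))
        (trans (cong undo (sym (preserves-fn f (Vec.map undo ms))))
               (Inverse.strictlyInverseʳ bijection _))
    ; preserves-rl = λ r ms → mk⇔
        (λ p → from (preserves-rl r _) (subst (Structure.⟦rl⟧ 𝔐 r) (sym (redo ms)) p))
        (λ p → subst (Structure.⟦rl⟧ 𝔐 r) (redo ms) (to (preserves-rl r _) p))
    }
    where
    open Automorphism σ renaming (to to app)

    undo : M → M
    undo = Inverse.from bijection

    redo : ∀ {n} (ms : Vec M n) → Vec.map app (Vec.map undo ms) ≡ ms
    redo ms = trans (sym (map-∘ app undo ms))
      (trans (map-cong (Inverse.strictlyInverseˡ bijection) ms) (map-id ms))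

  inverseˡ : ∀ σ m → Automorphism.to (σ ⁻¹) (Automorphism.to σ m) ≡ m
  inverseˡ σ = Inverse.strictlyInverseʳ (Automorphism.bijection σ)

  inverseʳ : ∀ σ m → Automorphism.to σ (Automorphism.to (σ ⁻¹) m) ≡ m
  inverseʳ σ = Inverse.strictlyInverseˡ (Automorphism.bijection σ)

  ⊨-≗ : ∀ {V : Set} {a b : V → M} φ → (∀ v → a v ≡ b v) → a ⊨ φ → b ⊨ φ
  ⊨-≗ φ e = ⊨-local φ (λ v _ → e v)

  module _ {V : Set} where

    Th : Pred (V → M) 0ℓ → Pred (FormulaIn L V) 0ℓ
    Th D φ = ∀ a → D a → a ⊨ φ

    -- The type-definable sets over ∅.
    Closed : Pred (V → M) 0ℓ → Set
    Closed D = ∀ a → (∀ φ → Th D φ → a ⊨ φ) → D a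

    closed-⇔ : ∀ {D D′ : Pred (V → M) 0ℓ} → (∀ a → D a ⇔ D′ a) → Closed D → Closed D′
    closed-⇔ e closed a h = to (e a) (closed a λ φ t → h φ (λ b → t b ∘ from (e b)))

    closed-⋂ : ∀ {K : Set} {D : K → Pred (V → M) 0ℓ} → (∀ k → Closed (D k)) →
               Closed (λ a → ∀ k → D k a)
    closed-⋂ closed a h k = closed k a (λ φ t → h φ (λ b d → t b (d k)))

    closed-∩ : ∀ {D D′ : Pred (V → M) 0ℓ} → Closed D → Closed D′ → Closed (λ a → D a × D′ a)
    closed-∩ closed closed′ a h =
      closed a (λ φ t → h φ (λ b → t b ∘ proj₁)) , closed′ a (λ φ t → h φ (λ b → t b ∘ proj₂))

    closed-⊨ : ∀ φ → Closed (_⊨ φ)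
    closed-⊨ φ a h = h φ (λ b → id)

    Orb : (V → M) → Pred (V → M) 0ℓ
    Orb a b = ∃[ σ ] (∀ v → Automorphism.to σ (a v) ≡ b v)

    orb-refl : ∀ {a} → Orb a a
    orb-refl = idᴬ , λ _ → refl

    -- Satisfying every formula true on the orbit of `a` means having the type of `a`, as negations
    -- are among these formulas; homogeneity then gives a conjugate.
    closed-Orb : V ≺κ → ∀ a → Closed (Orb a)
    closed-Orb V≺κ a b h = homogeneous V V≺κ a b (λ φ → mk⇔ (forth φ) (back φ))
      where
      forth : ∀ φ → a ⊨ φ → b ⊨ φ
      forth φ p = h φ (λ { _ (σ , e) → ⊨-≗ φ e (to (⊨-aut σ φ) p) })

      back : ∀ φ → b ⊨ φ → a ⊨ φ
      back φ p with em {a ⊨ φ}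
      ... | yes q = q
      ... | no ¬q = ⊥-elim (to (⊨-∼ φ) (forth (∼ φ) (from (⊨-∼ φ) ¬q)) p)

    closed-invariant : ∀ {D} → Closed D → ∀ {a b} → Orb a b → D a → D b
    closed-invariant closed (σ , e) d =
      closed _ (λ φ t → ⊨-≗ φ e (to (⊨-aut σ φ) (t _ d)))

    Th-∧ : ∀ {D} φ ψ → Th D φ → Th D ψ → Th D (φ ∧ ψ)
    Th-∧ φ ψ s t a d = from (⊨-∧ φ ψ) (s a d , t a d)

  closed-∘ : ∀ {V W : Set} (f : V → W) {D} → Closed D → Closed (λ a → D (a ∘ f))
  closed-∘ f closed a h =
    closed (a ∘ f) (λ φ t → to (⊨-mapVars f φ) (h (mapVars f φ) (λ b d → from (⊨-mapVars f φ) (t (b ∘ f) d))))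

  -- If no formula of `Th D` sufficed, compactness would realise `Th D`, `Th C` and `∼ χ` together,
  -- and closedness would put the realisation in `D` and `C`. Only `D` is replaced by a formula, so
  -- several closed sets can be shrunk in turn.
  shrink : ∀ {V W : Set} → W ≺κ → (f : V → W) → ∀ {D C} → Closed D → Closed C → ∀ χ →
           (∀ a → D (a ∘ f) → C a → a ⊨ χ) →
           ∃[ φ ] Th D φ × (∀ a → (a ∘ f) ⊨ φ → C a → a ⊨ χ)
  shrink {V} {W} W≺κ f {D} {C} closedD closedC χ h
    with em {∃[ φ ] Th D φ × (∀ a → (a ∘ f) ⊨ φ → C a → a ⊨ χ)}
  ... | yes found = found
  ... | no none = ⊥-elim (contradiction (Compactness.compactness ext κ saturated W≺κ p directed inhabited satisfiable))
    where
    p : Pred (FormulaIn L W) 0ℓ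
    p ψ = ∃[ φ ] Th D φ × (∀ a → (a ∘ f) ⊨ φ → C a → ¬ a ⊨ χ → a ⊨ ψ)

    directed : ∀ φ ψ → p φ → p ψ → ∃[ χ ] p χ × (∀ a → a ⊨ χ → a ⊨ φ × a ⊨ ψ)
    directed φ ψ (φ₀ , t , g) (ψ₀ , t′ , g′) = φ ∧ ψ ,
      (φ₀ ∧ ψ₀ , Th-∧ φ₀ ψ₀ t t′ , λ a q c n → let x , y = to (⊨-∧ φ₀ ψ₀) q in
        from (⊨-∧ φ ψ) (g a x c n , g′ a y c n)) ,
      λ a → to (⊨-∧ φ ψ)

    inhabited : ∃[ φ ] p φ
    inhabited = true , true , (λ a _ → ⊨-true {a = a}) , λ a _ _ _ → ⊨-true {a = a}

    satisfiable : ∀ ψ → p ψ → ∃[ a ] a ⊨ ψ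
    satisfiable ψ (φ , t , g) with em {∃[ a ] a ⊨ ψ}
    ... | yes found = found
    ... | no ¬ψ = ⊥-elim (none (φ , t , λ a q c → stable a λ ¬χ → ¬ψ (a , g a q c ¬χ)))
      where
      stable : ∀ a → ¬ ¬ a ⊨ χ → a ⊨ χ
      stable a ¬¬q with em {a ⊨ χ}
      ... | yes q = q
      ... | no ¬q = ⊥-elim (¬¬q ¬q)

    contradiction : ¬ (∃[ a ] (∀ φ → p φ → a ⊨ φ))
    contradiction (a , q) = to (⊨-∼ χ) (q (∼ χ) (true , (λ b _ → ⊨-true {a = b}) ,
        λ b _ _ → from (⊨-∼ χ)))
      (h a
        (closedD (a ∘ f) (λ φ t → to (⊨-mapVars f φ)
          (q (mapVars f φ) (φ , t , λ b r _ _ → from (⊨-mapVars f φ) r))))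
        (closedC a (λ φ t → q φ (true , (λ b _ → ⊨-true {a = b}) , λ b _ c _ → t b c))))

  -- It is enough to reach a conjugate of `a`, since an inverse automorphism then corrects the
  -- preimage. Failing that, `shrink` finds a formula true of `a` and false on the whole projection.
  closed-projection : ∀ {V W : Set} → V ≺κ → W ≺κ → (f : V → W) → ∀ {C} → Closed C →
                      Closed (λ a → ∃[ b ] C b × (∀ v → b (f v) ≡ a v))
  closed-projection V≺κ W≺κ f {C} closed a h with em {∃[ b ] C b × Orb a (b ∘ f)}
  ... | yes (b , c , σ , e) = (σ ⁻¹) ·ᵃ b , closed-invariant closed (σ ⁻¹ , λ _ → refl) c ,
        λ v → trans (cong (Automorphism.to (σ ⁻¹)) (sym (e v))) (inverseˡ σ (a v))
  ... | no none with shrink W≺κ f (closed-Orb V≺κ a) closed false (λ b o c → none (b , c , o))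
  ...   | φ , t , g = ⊥-elim (to (⊨-∼ φ) (h (∼ φ) avoids) (t a orb-refl))
    where
    avoids : Th (λ a → ∃[ b ] C b × (∀ v → b (f v) ≡ a v)) (∼ φ)
    avoids a′ (b , c , e) = from (⊨-∼ φ) (λ q → g b (⊨-≗ φ (λ v → sym (e v)) q) c)

  module _ (E : CountableRelation) where

    ⟦⟧-≗ : ∀ {a a′ b b′} → (∀ n → a n ≡ a′ n) → (∀ n → b n ≡ b′ n) → ⟦ E ⟧ a b → ⟦ E ⟧ a′ b′
    ⟦⟧-≗ e e′ p n = ⊨-≗ (E n) (λ { (inj₁ k) → e k ; (inj₂ k) → e′ k }) (p n)

    ⟦⟧-aut : ∀ σ {a b} → ⟦ E ⟧ a b → ⟦ E ⟧ (σ · a) (σ · b)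
    ⟦⟧-aut σ p n = ⊨-≗ (E n) (λ { (inj₁ _) → refl ; (inj₂ _) → refl }) (to (⊨-aut σ (E n)) (p n))

    closed-⟦⟧ : ∀ {W : Set} (f g : ℕ → W) → Closed (λ a → ⟦ E ⟧ (a ∘ f) (a ∘ g))
    closed-⟦⟧ f g = closed-⋂ λ n → closed-⇔
      (λ a → mk⇔ (⊨-≗ (E n) λ { (inj₁ _) → refl ; (inj₂ _) → refl })
                 (⊨-≗ (E n) λ { (inj₁ _) → refl ; (inj₂ _) → refl }))
      (closed-∘ [ f , g ]′ (closed-⊨ (E n)))

  -- The automorphism group acting on classes and tuples

  automorphisms : Group 0ℓ 0ℓ
  automorphisms = record
    { Carrier = Automorphism
    ; _≈_ = λ σ τ → ∀ m → Automorphism.to σ m ≡ Automorphism.to τ m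
    ; _∙_ = _∘ᴬ_
    ; ε = idᴬ
    ; _⁻¹ = _⁻¹
    ; isGroup = record
      { isMonoid = record
        { isSemigroup = record
          { isMagma = record
            { isEquivalence = record
              { refl = λ _ → refl
              ; sym = λ e m → sym (e m)
              ; trans = λ e f m → trans (e m) (f m)
              }
            ; ∙-cong = λ {σ} {σ′} {τ} {τ′} e f m → trans (e (Automorphism.to τ m)) (cong (Automorphism.to σ′) (f m))
            }
          ; assoc = λ _ _ _ _ → refl
          }
        ; identity = (λ _ _ → refl) , (λ _ _ → refl)
        }
      ; inverse = inverseˡ , inverseʳ
      ; ⁻¹-cong = λ {σ} {τ} e m → trans (cong (Automorphism.to (σ ⁻¹)) (sym (inverseʳ τ m)))
          (trans (cong (Automorphism.to (σ ⁻¹)) (sym (e _))) (inverseˡ σ _))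
      }
    }

  open Conjugacies automorphisms

  classConjugacy : Hyperimaginary → Conjugacy
  classConjugacy e = record
    { _≈_ = λ α β → ⟦ type ⟧ (α · rep) (β · rep)
    ; ≈-isEquivalence = record { refl = reflexive ; sym = symmetric ; trans = transitive }
    ; left = λ γ → ⟦⟧-aut type γ
    ; reflexive = λ {α} {β} e → ⟦⟧-≗ type (λ _ → refl) (λ n → e (rep n)) (reflexive {α · rep})
    }
    where
    open Hyperimaginary e
    open IsEquivalence isEquivalence using () renaming (refl to reflexive; sym to symmetric; trans to transitive)

  module Tuples (X : HyperdefinableSet) where
    open HyperdefinableSet X using (Z; E)

    open IsEquivalence (HyperdefinableSet.isEquivalence X) public
      using () renaming (refl to E-refl; sym to E-sym; trans to E-trans)

    infixr 9 _⊙_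
    _⊙_ : Automorphism → Element X → Element X
    σ ⊙ (a , h) = σ · a , λ φ z → to (⊨-aut σ φ) (h φ z)

    tupleConjugacy : ∀ {I : Set} → (I → Element X) → Conjugacy
    tupleConjugacy a = record
      { _≈_ = λ α β → ∀ i → ⟦ E ⟧ (α · proj₁ (a i)) (β · proj₁ (a i))
      ; ≈-isEquivalence = record
        { refl = λ {α} i → E-refl {α ⊙ a i}
        ; sym = λ {α} {β} e i → E-sym {α ⊙ a i} {β ⊙ a i} (e i)
        ; trans = λ {α} {β} {γ} e f i → E-trans {α ⊙ a i} {β ⊙ a i} {γ ⊙ a i} (e i) (f i)
        }
      ; left = λ γ e i → ⟦⟧-aut E γ (e i)
      ; reflexive = λ {α} {β} e i → ⟦⟧-≗ E (λ _ → refl) (λ n → e (proj₁ (a i) n)) (E-refl {α ⊙ a i})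
      }

    flatten : ∀ {I : Set} → (I → Element X) → I × ℕ → M
    flatten a (i , n) = proj₁ (a i) n

  orthogonal : ∀ X Y → X ⊥∅ Y → ∀ {I J} → I ≺κ → J ≺κ → (a : I → Element X) (b : J → Element Y) →
               Orthogonal (Tuples.tupleConjugacy X a) (Tuples.tupleConjugacy Y b)
  orthogonal X Y X⊥Y {I} {J} I≺κ J≺κ a b τ₁ γ δ τ₂ ε ζ =
    let ρ , p , q = X⊥Y (I ⊎ I) (J ⊎ J) (⊎-≺κ ℕ≺κ I≺κ I≺κ) (⊎-≺κ ℕ≺κ J≺κ J≺κ)
            [ (γ ⊙ᵃ_) ∘ a , (δ ⊙ᵃ_) ∘ a ]′ [ (τ₁ ⊙ᵃ_) ∘ (γ ⊙ᵃ_) ∘ a , (τ₁ ⊙ᵃ_) ∘ (δ ⊙ᵃ_) ∘ a ]′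
            [ (ε ⊙ᵇ_) ∘ b , (ζ ⊙ᵇ_) ∘ b ]′ [ (τ₂ ⊙ᵇ_) ∘ (ε ⊙ᵇ_) ∘ b , (τ₂ ⊙ᵇ_) ∘ (ζ ⊙ᵇ_) ∘ b ]′
            (τ₁ , λ { (inj₁ i) → TX.E-refl {τ₁ ⊙ᵃ γ ⊙ᵃ a i} ; (inj₂ i) → TX.E-refl {τ₁ ⊙ᵃ δ ⊙ᵃ a i} })
            (τ₂ , λ { (inj₁ j) → TY.E-refl {τ₂ ⊙ᵇ ε ⊙ᵇ b j} ; (inj₂ j) → TY.E-refl {τ₂ ⊙ᵇ ζ ⊙ᵇ b j} })
    in ρ , ((λ i → p (inj₁ i)) , (λ i → p (inj₂ i))) , ((λ j → q (inj₁ j)) , (λ j → q (inj₂ j)))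
    where
    module TX = Tuples X
    module TY = Tuples Y
    open TX using () renaming (_⊙_ to _⊙ᵃ_)
    open TY using () renaming (_⊙_ to _⊙ᵇ_)

  -- σe is recovered from the type-definable set of pairs conjugate to (σe , e),
  -- so the orbit is at most as large as the collection of sets of formulas.
  bdd-criterion : ∀ {I : Set} {B : I → Class} (e : Hyperimaginary) →
    (∀ σ τ → FixesPointwise σ B → τ fixes class e →
       ⟦ Hyperimaginary.type e ⟧ ((τ ∘ᴬ σ) · Hyperimaginary.rep e) (σ · Hyperimaginary.rep e)) →
    e ∈ bdd B
  bdd-criterion {I} {B} e fixed = ≺-injection injection large
    where
    open Hyperimaginary e
    open IsEquivalence isEquivalence using () renaming (refl to reflexive; sym to symmetric; trans to transitive)
    module C = Conjugacy (classConjugacy e)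

    D : Automorphism → Pred (ℕ ⊎ ℕ → M) 0ℓ
    D σ ρ = ∃[ τ ] (∀ n → Automorphism.to τ (rep n) ≡ ρ (inj₂ n)) × ⟦ type ⟧ (ρ ∘ inj₁) (τ · σ · rep)

    closed-D : ∀ σ → Closed (D σ)
    closed-D σ = closed-⇔
      (λ ρ → mk⇔
        (λ { (ρ′ , ((τ , o) , r) , ρ′≗ρ) → τ , (λ n → trans (o (inj₁ n)) (ρ′≗ρ (inj₂ n))) ,
             ⟦⟧-≗ type (λ n → ρ′≗ρ (inj₁ n)) (λ n → sym (o (inj₂ n))) r })
        (λ { (τ , o , r) → [ ρ , τ · σ · rep ]′ ,
             ((τ , λ { (inj₁ n) → o n ; (inj₂ n) → refl }) , r) , λ _ → refl }))
      (closed-projection (⊎-≺κ ℕ≺κ ℕ≺κ ℕ≺κ) (⊎-≺κ ℕ≺κ (⊎-≺κ ℕ≺κ ℕ≺κ ℕ≺κ) ℕ≺κ) inj₁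
        (closed-∩
          (closed-∘ [ inj₁ ∘ inj₂ , inj₂ ]′ (closed-Orb (⊎-≺κ ℕ≺κ ℕ≺κ ℕ≺κ) [ rep , σ · rep ]′))
          (closed-⟦⟧ type (inj₁ ∘ inj₁) inj₂)))

    D-mono : ∀ σ σ′ → ⟦ type ⟧ (σ · rep) (σ′ · rep) → ∀ ρ → D σ ρ → D σ′ ρ
    D-mono σ σ′ r ρ (τ , o , s) = τ , o , transitive s (⟦⟧-aut type τ r)

    -- `large` counts formulas with variables in `ℕ`, whereas `D σ` concerns pairs of ω-tuples, so
    -- the two blocks of variables are coded into one.
    split : ℕ → ℕ ⊎ ℕ
    split n with unpair n
    ... | zero  , m = inj₁ m
    ... | suc _ , m = inj₂ m

    merge : ℕ ⊎ ℕ → ℕ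
    merge (inj₁ m) = pair (0 , m)
    merge (inj₂ m) = pair (1 , m)

    split-merge : ∀ v → split (merge v) ≡ v
    split-merge (inj₁ m) rewrite unpair-pair (0 , m) = refl
    split-merge (inj₂ m) rewrite unpair-pair (1 , m) = refl

    recode : ∀ {ρ : ℕ ⊎ ℕ → M} φ → ρ ⊨ mapVars split (mapVars merge φ) ⇔ ρ ⊨ φ
    recode {ρ} φ = mk⇔
      (λ p → ⊨-≗ φ (λ v → cong ρ (split-merge v)) (to (⊨-mapVars merge φ) (to (⊨-mapVars split (mapVars merge φ)) p)))
      (λ p → from (⊨-mapVars split (mapVars merge φ)) (from (⊨-mapVars merge φ)
               (⊨-≗ φ (λ v → cong ρ (sym (split-merge v))) p)))

    theory : Automorphism → FormulaIn L ℕ → Bool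
    theory σ φ = does (em {Th (D σ) (mapVars split φ)})

    theory-cong : ∀ σ τ → ⟦ type ⟧ (σ · rep) (τ · rep) → theory σ ≡ theory τ
    theory-cong σ τ r = ext λ φ → does-⇔
      (mk⇔ (λ (t : Th (D σ) (mapVars split φ)) ρ d → t ρ (D-mono τ σ (symmetric r) ρ d))
           (λ (t : Th (D τ) (mapVars split φ)) ρ d → t ρ (D-mono σ τ r ρ d)))
      em em

    theory-reflects : ∀ σ τ → theory σ ≡ theory τ → ∀ φ →
                      Th (D τ) (mapVars split φ) → Th (D σ) (mapVars split φ)
    theory-reflects σ τ eq φ t
      with em {Th (D σ) (mapVars split φ)} | em {Th (D τ) (mapVars split φ)} | cong (λ f → f φ) eq
    ... | yes s | _ | _ = s
    ... | no _ | no ¬t | _ = ⊥-elim (¬t t)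

    conjugate : ∀ σ τ → theory σ ≡ theory τ → D τ [ σ · rep , rep ]′
    conjugate σ τ eq = closed-D τ _ λ φ t →
      to (recode φ) (theory-reflects σ τ eq (mapVars merge φ) (λ ρ d → from (recode φ) (t ρ d))
        [ σ · rep , rep ]′ (idᴬ , (λ _ → refl) , reflexive))

    recover : ∀ σ τ → FixesPointwise τ B → theory σ ≡ theory τ → ⟦ type ⟧ (σ · rep) (τ · rep)
    recover σ τ fixτ eq =
      -- `υ` fixes the representative of e, hence e, and carries τe to σe. By hypothesis `υ` then
      -- fixes τe, so σe = τe.
      let υ , o , r = conjugate σ τ eq in
      transitive r (fixed τ υ fixτ (⟦⟧-≗ type (λ n → sym (o n)) (λ _ → refl) reflexive))

    injection : Injection (Orbit B e) (setoid (FormulaIn L ℕ → Bool))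
    injection = record
      { to = λ s → theory (proj₁ s)
      ; cong = λ {s} {t} r → theory-cong (proj₁ s) (proj₁ t) r
      ; injective = λ {s} {t} eq → recover (proj₁ s) (proj₁ t) (proj₂ t) eq
      }

  -- Only the countably many variables occurring in the Θ n matter, so the class
  -- has a countable representative although a may be uncountable.  Equality is
  -- added as a disjunct because D is reflexive only on the conjugates of a.
  module Presentation
    {V : Set} (V≺κ : V ≺κ) (D : Pred (V ⊎ V → M) 0ℓ) (closed : Closed D)
    (D-sym : ∀ ρ → D ρ → D (ρ ∘ Sum.swap))
    (D-trans : ∀ (ρ : V ⊎ V ⊎ V → M) → D (ρ ∘ Sum.map₂ inj₁) → D (ρ ∘ inj₂) → D (ρ ∘ Sum.map₂ inj₂))
    (a : V → M) (D-refl : ∀ α → D [ α ·ᵃ a , α ·ᵃ a ]′)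
    (θ : ℕ → FormulaIn L (V ⊎ V)) (D⇒θ : ∀ n → Th D (θ n)) (default : M)
    where

    -- The inclusion D ∘ D ⊆ D is brought down to formulas by shrinking the two copies of D in turn;
    -- the conjunction of the formulas found serves in both places.
    half : ∀ φ → Th D φ → ∃[ ψ ] Th D ψ ×
           (∀ (ρ : V ⊎ V ⊎ V → M) → (ρ ∘ Sum.map₂ inj₁) ⊨ ψ → (ρ ∘ inj₂) ⊨ ψ → (ρ ∘ Sum.map₂ inj₂) ⊨ φ)
    half φ t =
      let W≺κ = ⊎-≺κ ℕ≺κ V≺κ (⊎-≺κ ℕ≺κ V≺κ V≺κ)
          φ₁ , t₁ , h₁ = shrink W≺κ (Sum.map₂ inj₁) closed (closed-∘ inj₂ closed)
            (mapVars (Sum.map₂ inj₂) φ)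
            (λ ρ d d′ → from (⊨-mapVars (Sum.map₂ inj₂) φ) (t (ρ ∘ Sum.map₂ inj₂) (D-trans ρ d d′)))
          φ₂ , t₂ , h₂ = shrink W≺κ inj₂ closed (closed-∘ (Sum.map₂ inj₁) (closed-⊨ φ₁))
            (mapVars (Sum.map₂ inj₂) φ) (λ ρ d q → h₁ ρ q d)
      in φ₁ ∧ φ₂ , Th-∧ φ₁ φ₂ t₁ t₂ , λ ρ p q → to (⊨-mapVars (Sum.map₂ inj₂) φ)
           (h₂ ρ (proj₂ (to (⊨-∧ φ₁ φ₂) q)) (proj₁ (to (⊨-∧ φ₁ φ₂) p)))

    symmetrise : ∀ φ → Th D φ → ∃[ ψ ] Th D ψ × (∀ ρ → ρ ⊨ ψ → ρ ⊨ φ) × (∀ ρ → ρ ⊨ ψ → (ρ ∘ Sum.swap) ⊨ ψ)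
    symmetrise φ t = φ ∧ φ′ , Th-∧ φ φ′ t (λ ρ d → from swapped (t (ρ ∘ Sum.swap) (D-sym ρ d))) ,
      (λ ρ p → proj₁ (to (⊨-∧ φ φ′) p)) ,
      λ ρ p → let x , y = to (⊨-∧ φ φ′) p in
        from (⊨-∧ φ φ′) (to swapped y , from swapped (⊨-≗ φ (λ v → cong ρ (sym (swap-involutive v))) x))
      where
      φ′ = mapVars Sum.swap φ

      swapped : ∀ {ρ} → ρ ⊨ φ′ ⇔ (ρ ∘ Sum.swap) ⊨ φ
      swapped = ⊨-mapVars Sum.swap φ

    -- As in the metrisation of a uniformity, each formula is symmetric and its composition with
    -- itself lies in the preceding one, so the intersection is symmetric and transitive. Stage `n`
    -- takes in `θ n`, which makes the intersection fine enough.
    chain : ℕ → Σ (FormulaIn L (V ⊎ V)) (Th D)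
    stage : ∀ n → ∃[ φ ] Th D φ × (∀ ρ → ρ ⊨ φ → ρ ⊨ θ n)

    stage zero = θ 0 , D⇒θ 0 , λ _ → id
    stage (suc n) =
      let φ , t = chain n
          ψ , u , _ = half φ t
      in θ (suc n) ∧ ψ , Th-∧ (θ (suc n)) ψ (D⇒θ (suc n)) u , λ ρ → proj₁ ∘ to (⊨-∧ (θ (suc n)) ψ)

    chain n = let φ , t , _ = stage n
                  ψ , u , _ = symmetrise φ t
              in ψ , u

    Θ : ℕ → FormulaIn L (V ⊎ V)
    Θ = proj₁ ∘ chain

    D⇒Θ : ∀ n → Th D (Θ n)
    D⇒Θ = proj₂ ∘ chain

    Θ⇒stage : ∀ n ρ → ρ ⊨ Θ n → ρ ⊨ proj₁ (stage n)
    Θ⇒stage n = proj₁ (proj₂ (proj₂ (symmetrise (proj₁ (stage n)) (proj₁ (proj₂ (stage n))))))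

    Θ⇒θ : ∀ n ρ → ρ ⊨ Θ n → ρ ⊨ θ n
    Θ⇒θ n ρ p = proj₂ (proj₂ (stage n)) ρ (Θ⇒stage n ρ p)

    Θ-sym : ∀ n ρ → ρ ⊨ Θ n → (ρ ∘ Sum.swap) ⊨ Θ n
    Θ-sym n = proj₂ (proj₂ (proj₂ (symmetrise (proj₁ (stage n)) (proj₁ (proj₂ (stage n))))))

    Θ-trans : ∀ n (ρ : V ⊎ V ⊎ V → M) → (ρ ∘ Sum.map₂ inj₁) ⊨ Θ (suc n) → (ρ ∘ inj₂) ⊨ Θ (suc n) →
              (ρ ∘ Sum.map₂ inj₂) ⊨ Θ n
    Θ-trans n ρ p q = proj₂ (proj₂ (half (Θ n) (D⇒Θ n))) ρ (halved p) (halved q)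
      where
      halved : ∀ {σ} → σ ⊨ Θ (suc n) → σ ⊨ proj₁ (half (Θ n) (D⇒Θ n))
      halved {σ} r = proj₂ (to (⊨-∧ (θ (suc n)) (proj₁ (half (Θ n) (D⇒Θ n)))) (Θ⇒stage (suc n) σ r))

    -- A number codes a place in one of the formulas `Θ k`, and through it the variable there, with
    -- both copies of V identified. A variable may have several codes, a code only one variable.
    Codes : ℕ → V → Set
    Codes n v = ∃[ k ] Σ[ i ∈ Fin (FormulaIn.arity (Θ k)) ]
      pair (k , toℕ i) ≡ n × [ id , id ]′ (lookup (FormulaIn.vars (Θ k)) i) ≡ v

    codes-functional : ∀ {n v w} → Codes n v → Codes n w → v ≡ w
    codes-functional (k , i , e , ev) (l , j , f , fw)
      with pair-injective (k , toℕ i) (l , toℕ j) (trans e (sym f))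
    ... | kl with cong proj₁ kl | cong proj₂ kl
    ...   | refl | ij with toℕ-injective ij
    ...     | refl = trans (sym ev) fw

    -- The value 0 at variables occurring in no `Θ k` is harmless: no `Θ k` reads it.
    code : V → ℕ
    code v with em {∃[ n ] Codes n v}
    ... | yes (n , _) = n
    ... | no _ = 0

    Used : V → Set
    Used v = Codes (code v) v

    codes⇒used : ∀ {n v} → Codes n v → Used v
    codes⇒used {n} {v} c with em {∃[ n ] Codes n v}
    ... | yes (_ , c′) = c′
    ... | no none = ⊥-elim (none (n , c))

    occurs⇒used : ∀ k {x} → x ∈ᵛ FormulaIn.vars (Θ k) → Used ([ id , id ]′ x)
    occurs⇒used k x∈ = codes⇒used (k , index x∈ , refl , cong [ id , id ]′ (sym (lookup-index x∈)))

    rep : ωTuple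
    rep n with em {∃[ v ] Codes n v}
    ... | yes (v , _) = a v
    ... | no _ = default

    rep-code : ∀ {v} → Used v → rep (code v) ≡ a v
    rep-code {v} u with em {∃[ w ] Codes (code v) w}
    ... | yes (w , c) = cong a (codes-functional c u)
    ... | no none = ⊥-elim (none (v , u))

    -- Distributivity turns the disjunction of two infinite conjunctions, all `Θ k` or all
    -- equalities, into a conjunction over the pairs `(k , m)`.
    relation : ℕ → ℕ → FormulaIn L (ℕ ⊎ ℕ)
    relation k m = mapVars (Sum.map code code) (Θ k) ∨ equal (inj₁ m) (inj₂ m)

    type : CountableRelation
    type n = uncurry relation (unpair n)

    _≋_ : Rel ωTuple 0ℓ
    s ≋ t = (∀ k → [ s ∘ code , t ∘ code ]′ ⊨ Θ k) ⊎ (∀ m → s m ≡ t m)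

    decode : ∀ {s t} k → [ s , t ]′ ⊨ mapVars (Sum.map code code) (Θ k) ⇔ [ s ∘ code , t ∘ code ]′ ⊨ Θ k
    decode {s} {t} k = mk⇔
      (λ p → ⊨-≗ (Θ k) (λ { (inj₁ _) → refl ; (inj₂ _) → refl }) (to (⊨-mapVars (Sum.map code code) (Θ k)) p))
      (λ p → from (⊨-mapVars (Sum.map code code) (Θ k)) (⊨-≗ (Θ k) (λ { (inj₁ _) → refl ; (inj₂ _) → refl }) p))

    ⟦type⟧⇒≋ : ∀ s t → ⟦ type ⟧ s t → s ≋ t
    ⟦type⟧⇒≋ s t p with em {∀ k → [ s ∘ code , t ∘ code ]′ ⊨ Θ k}
    ... | yes q = inj₁ q
    ... | no ¬q = inj₂ λ m → agree m
      where
      entry : ∀ k m → [ s , t ]′ ⊨ relation k m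
      entry k m = subst (λ km → [ s , t ]′ ⊨ uncurry relation km) (unpair-pair (k , m)) (p (pair (k , m)))

      agree : ∀ m → s m ≡ t m
      agree m with em {s m ≡ t m}
      ... | yes e = e
      ... | no s≢t = ⊥-elim (¬q λ k →
        [ to (decode k) , (λ e → ⊥-elim (s≢t e)) ]′
          (to (⊨-∨ (mapVars (Sum.map code code) (Θ k)) (equal (inj₁ m) (inj₂ m))) (entry k m)))

    ≋⇒⟦type⟧ : ∀ s t → s ≋ t → ⟦ type ⟧ s t
    ≋⇒⟦type⟧ s t p n with unpair n
    ... | k , m = from (⊨-∨ (mapVars (Sum.map code code) (Θ k)) (equal (inj₁ m) (inj₂ m)))
                    (Sum.map (λ q → from (decode k) (q k)) (λ e → e m) p)

    ≋-sym : ∀ {s t} → s ≋ t → t ≋ s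
    ≋-sym (inj₁ p) = inj₁ λ k → ⊨-≗ (Θ k) (λ { (inj₁ _) → refl ; (inj₂ _) → refl }) (Θ-sym k _ (p k))
    ≋-sym (inj₂ e) = inj₂ λ m → sym (e m)

    ≋-trans : ∀ {s t u} → s ≋ t → t ≋ u → s ≋ u
    ≋-trans {s} {t} {u} (inj₁ p) (inj₁ q) = inj₁ λ k →
      ⊨-≗ (Θ k) (λ { (inj₁ _) → refl ; (inj₂ _) → refl })
        (Θ-trans k [ s ∘ code , [ t ∘ code , u ∘ code ]′ ]′
          (⊨-≗ (Θ (suc k)) (λ { (inj₁ _) → refl ; (inj₂ _) → refl }) (p (suc k)))
          (⊨-≗ (Θ (suc k)) (λ _ → refl) (q (suc k))))
    ≋-trans (inj₁ p) (inj₂ e) = inj₁ λ k → ⊨-≗ (Θ k) (λ { (inj₁ _) → refl ; (inj₂ v) → e (code v) }) (p k)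
    ≋-trans (inj₂ e) (inj₁ p) = inj₁ λ k →
      ⊨-≗ (Θ k) (λ { (inj₁ v) → sym (e (code v)) ; (inj₂ _) → refl }) (p k)
    ≋-trans (inj₂ e) (inj₂ f) = inj₂ λ m → trans (e m) (f m)

    hyperimaginary : Hyperimaginary
    hyperimaginary = record
      { rep = rep
      ; type = type
      ; isEquivalence = record
        { refl = λ {s} → ≋⇒⟦type⟧ s s (inj₂ λ _ → refl)
        ; sym = λ {s} {t} p → ≋⇒⟦type⟧ t s (≋-sym (⟦type⟧⇒≋ s t p))
        ; trans = λ {s} {t} {u} p q → ≋⇒⟦type⟧ s u (≋-trans (⟦type⟧⇒≋ s t p) (⟦type⟧⇒≋ t u q))
        }
      }

    translate : ∀ α β k → [ (α · rep) ∘ code , (β · rep) ∘ code ]′ ⊨ Θ k ⇔ [ α ·ᵃ a , β ·ᵃ a ]′ ⊨ Θ k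
    translate α β k = mk⇔ (⊨-local (Θ k) same) (⊨-local (Θ k) (λ v v∈ → sym (same v v∈)))
      where
      same : ∀ v → v ∈ᵛ FormulaIn.vars (Θ k) → [ (α · rep) ∘ code , (β · rep) ∘ code ]′ v ≡ [ α ·ᵃ a , β ·ᵃ a ]′ v
      same (inj₁ v) v∈ = cong (Automorphism.to α) (rep-code (occurs⇒used k v∈))
      same (inj₂ v) v∈ = cong (Automorphism.to β) (rep-code (occurs⇒used k v∈))

    coarser : ∀ α β → D [ α ·ᵃ a , β ·ᵃ a ]′ → ⟦ type ⟧ (α · rep) (β · rep)
    coarser α β d = ≋⇒⟦type⟧ (α · rep) (β · rep) (inj₁ λ k → from (translate α β k) (D⇒Θ k _ d))

    finer : ∀ α β → ⟦ type ⟧ (α · rep) (β · rep) → ∀ n → [ α ·ᵃ a , β ·ᵃ a ]′ ⊨ θ n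
    finer α β p n = Θ⇒θ n _ (to (translate α β n) (holds (⟦type⟧⇒≋ (α · rep) (β · rep) p)))
      where
      holds : (α · rep) ≋ (β · rep) → [ (α · rep) ∘ code , (β · rep) ∘ code ]′ ⊨ Θ n
      holds (inj₁ q) = q n
      -- Here αa and βa coincide at the variables of `Θ n`, so reflexivity of D on conjugates gives
      -- the formula.
      holds (inj₂ e) = ⊨-≗ (Θ n) (λ { (inj₁ _) → refl ; (inj₂ v) → e (code v) })
        (from (translate α α n) (D⇒Θ n _ (D-refl α)))

  -- Type-definability of the fibre relation

  module FibreSet
    (X Y : HyperdefinableSet) {I J : Set} (I≺κ : I ≺κ) (J≺κ : J ≺κ)
    (a : I → Element X) (b : J → Element Y) (z : Hyperimaginary)
    (orth : Orthogonal (Tuples.tupleConjugacy X a) (Tuples.tupleConjugacy Y b))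
    (det : Determines (Tuples.tupleConjugacy X a) (Tuples.tupleConjugacy Y b) (classConjugacy z))
    where

    open Hyperimaginary z using () renaming (rep to c; type to E)

    private
      module X = HyperdefinableSet X
      module Y = HyperdefinableSet Y
      module A = Conjugacy (Tuples.tupleConjugacy X a)
      module B = Conjugacy (Tuples.tupleConjugacy Y b)
      module Z = Conjugacy (classConjugacy z)

    open Fibre (Tuples.tupleConjugacy X a) (Tuples.tupleConjugacy Y b) (classConjugacy z) orth det public

    V : Set
    V = I × ℕ

    V≺κ : V ≺κ
    V≺κ = ×ℕ-≺κ ℕ≺κ I≺κ

    Joint : Set
    Joint = V ⊎ (J × ℕ) ⊎ ℕ

    Joint≺κ : Joint ≺κ
    Joint≺κ = ⊎-≺κ ℕ≺κ V≺κ (⊎-≺κ ℕ≺κ (×ℕ-≺κ ℕ≺κ J≺κ) ℕ≺κ)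

    ã : V → M
    ã = Tuples.flatten X a

    abc : Joint → M
    abc = [ ã , [ Tuples.flatten Y b , c ]′ ]′

    -- The relation `≈ᶠ` carried over from automorphisms to conjugates of the representatives. The
    -- choice of α and β does not matter, since automorphisms agreeing on `ã` agree on a.
    D : Pred (V ⊎ V → M) 0ℓ
    D ρ = ∃[ α ] ∃[ β ] (∀ v → Automorphism.to α (ã v) ≡ ρ (inj₁ v)) ×
                        (∀ v → Automorphism.to β (ã v) ≡ ρ (inj₂ v)) × α ≈ᶠ β

    same-tuple : ∀ {α β} → (∀ v → Automorphism.to α (ã v) ≡ Automorphism.to β (ã v)) → α A.≈ β
    same-tuple {α} {β} e i = ⟦⟧-≗ X.E (λ _ → refl) (λ n → e (i , n)) (A.≈-refl {α} i)

    D-intro : ∀ α β → α ≈ᶠ β → D [ α ·ᵃ ã , β ·ᵃ ã ]′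
    D-intro α β r = α , β , (λ _ → refl) , (λ _ → refl) , r

    D-elim : ∀ α β → D [ α ·ᵃ ã , β ·ᵃ ã ]′ → α ≈ᶠ β
    D-elim α β (α′ , β′ , e , f , r) = ≈ᶠ-resp {α′} {α} {β′} {β} (same-tuple {α′} {α} e) (same-tuple {β′} {β} f) r

    D-sym : ∀ ρ → D ρ → D (ρ ∘ Sum.swap)
    D-sym ρ (α , β , e , f , r) = β , α , f , e , ≈ᶠ-sym {α} {β} r

    D-trans : ∀ (ρ : V ⊎ V ⊎ V → M) → D (ρ ∘ Sum.map₂ inj₁) → D (ρ ∘ inj₂) → D (ρ ∘ Sum.map₂ inj₂)
    D-trans ρ (α , β , e , f , r) (β′ , γ , e′ , f′ , r′) = α , γ , e , f′ ,
      ≈ᶠ-trans {α} {β} {γ} r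
        (≈ᶠ-resp {β′} {β} {γ} {γ} (same-tuple {β′} {β} λ v → trans (e′ v) (sym (f v))) (A.≈-refl {γ}) r′)

    D-refl : ∀ α → D [ α ·ᵃ ã , α ·ᵃ ã ]′
    D-refl α = D-intro α α (≈ᶠ-of-≈ {α} {α} (A.≈-refl {α}))

    -- The variables stand for αã, βã and for the conjugates of ãb̃c under γ
    -- and δ in the definition of α ≈ᶠ β.
    Witness : Pred ((V ⊎ V) ⊎ (Joint ⊎ Joint) → M) 0ℓ
    Witness ρ =
      (Orb ã (ρ ∘ inj₁ ∘ inj₁) × Orb ã (ρ ∘ inj₁ ∘ inj₂)) ×
      (Orb abc (ρ ∘ inj₂ ∘ inj₁) × Orb abc (ρ ∘ inj₂ ∘ inj₂)) ×
      ((∀ i → ⟦ X.E ⟧ (λ n → ρ (inj₂ (inj₁ (inj₁ (i , n))))) (λ n → ρ (inj₁ (inj₁ (i , n))))) ×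
       (∀ i → ⟦ X.E ⟧ (λ n → ρ (inj₂ (inj₂ (inj₁ (i , n))))) (λ n → ρ (inj₁ (inj₂ (i , n)))))) ×
      (∀ j → ⟦ Y.E ⟧ (λ n → ρ (inj₂ (inj₁ (inj₂ (inj₁ (j , n))))))
                     (λ n → ρ (inj₂ (inj₂ (inj₂ (inj₁ (j , n))))))) ×
      ⟦ E ⟧ (λ n → ρ (inj₂ (inj₁ (inj₂ (inj₂ n))))) (λ n → ρ (inj₂ (inj₂ (inj₂ (inj₂ n)))))

    closed-Witness : Closed Witness
    closed-Witness =
      closed-∩ (closed-∩ (closed-∘ (inj₁ ∘ inj₁) (closed-Orb V≺κ ã))
                         (closed-∘ (inj₁ ∘ inj₂) (closed-Orb V≺κ ã)))
      (closed-∩ (closed-∩ (closed-∘ (inj₂ ∘ inj₁) (closed-Orb Joint≺κ abc))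
                          (closed-∘ (inj₂ ∘ inj₂) (closed-Orb Joint≺κ abc)))
      (closed-∩ (closed-∩ (closed-⋂ λ i → closed-⟦⟧ X.E (λ n → inj₂ (inj₁ (inj₁ (i , n)))) (λ n → inj₁ (inj₁ (i , n))))
                          (closed-⋂ λ i → closed-⟦⟧ X.E (λ n → inj₂ (inj₂ (inj₁ (i , n)))) (λ n → inj₁ (inj₂ (i , n)))))
      (closed-∩ (closed-⋂ λ j → closed-⟦⟧ Y.E (λ n → inj₂ (inj₁ (inj₂ (inj₁ (j , n)))))
                                              (λ n → inj₂ (inj₂ (inj₂ (inj₁ (j , n))))))
                (closed-⟦⟧ E (λ n → inj₂ (inj₁ (inj₂ (inj₂ n)))) (λ n → inj₂ (inj₂ (inj₂ (inj₂ n))))))))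

    Projected : Pred (V ⊎ V → M) 0ℓ
    Projected ρ = ∃[ ρ′ ] Witness ρ′ × (∀ v → ρ′ (inj₁ v) ≡ ρ v)

    projected⇒D : ∀ ρ → Projected ρ → D ρ
    projected⇒D ρ (ρ′ , (((α , eα) , (β , eβ)) , ((γ , eγ) , (δ , eδ)) , (rγ , rδ) , rb , rz) , ρ′≗ρ) =
      α , β , (λ v → trans (eα v) (ρ′≗ρ (inj₁ v))) , (λ v → trans (eβ v) (ρ′≗ρ (inj₂ v))) , γ , δ ,
      (λ i → ⟦⟧-≗ X.E (λ n → sym (eγ (inj₁ (i , n)))) (λ n → sym (eα (i , n))) (rγ i)) ,
      (λ i → ⟦⟧-≗ X.E (λ n → sym (eδ (inj₁ (i , n)))) (λ n → sym (eβ (i , n))) (rδ i)) ,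
      (λ j → ⟦⟧-≗ Y.E (λ n → sym (eγ (inj₂ (inj₁ (j , n))))) (λ n → sym (eδ (inj₂ (inj₁ (j , n))))) (rb j)) ,
      ⟦⟧-≗ E (λ n → sym (eγ (inj₂ (inj₂ n)))) (λ n → sym (eδ (inj₂ (inj₂ n)))) rz

    D⇒projected : ∀ ρ → D ρ → Projected ρ
    D⇒projected ρ (α , β , eα , eβ , γ , δ , rγ , rδ , rb , rz) =
      [ ρ , [ γ ·ᵃ abc , δ ·ᵃ abc ]′ ]′ ,
      (((α , eα) , (β , eβ)) , ((γ , λ _ → refl) , (δ , λ _ → refl)) ,
       ((λ i → ⟦⟧-≗ X.E (λ _ → refl) (λ n → eα (i , n)) (rγ i)) ,
        (λ i → ⟦⟧-≗ X.E (λ _ → refl) (λ n → eβ (i , n)) (rδ i))) ,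
       rb , rz) ,
      λ _ → refl

    closed-D : Closed D
    closed-D = closed-⇔ (λ ρ → mk⇔ (projected⇒D ρ) (D⇒projected ρ))
      (closed-projection (⊎-≺κ ℕ≺κ V≺κ V≺κ)
        (⊎-≺κ ℕ≺κ (⊎-≺κ ℕ≺κ V≺κ V≺κ) (⊎-≺κ ℕ≺κ Joint≺κ Joint≺κ)) inj₁ closed-Witness)

  -- Extraction of x and y

  module Elimination
    (X Y : HyperdefinableSet) {I J : Set} (I≺κ : I ≺κ) (J≺κ : J ≺κ)
    (a : I → Element X) (b : J → Element Y) (z : Hyperimaginary)
    (orth : Orthogonal (Tuples.tupleConjugacy X a) (Tuples.tupleConjugacy Y b))
    (det : Determines (Tuples.tupleConjugacy X a) (Tuples.tupleConjugacy Y b) (classConjugacy z))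
    where

    private
      A = Tuples.tupleConjugacy X a
      B = Tuples.tupleConjugacy Y b
      module A = Conjugacy A
      module B = Conjugacy B
      module Z = Conjugacy (classConjugacy z)
      module R = Rectangle A B (classConjugacy z) orth det
      module FX = FibreSet X Y I≺κ J≺κ a b z orth det
      module FY = FibreSet Y X J≺κ I≺κ b a z (Orthogonal-sym {A} {B} orth) (λ γ δ p q → det γ δ q p)

    open Hyperimaginary z using () renaming (rep to c; type to E)

    -- On pairs of conjugates of abc the two fibre relations together imply `E n` by the rectangle
    -- argument. Shrinking one relation and then the other leaves one formula of each.
    separate : ∀ n → ∃[ θ ] ∃[ η ] Th FX.D θ × Th FY.D η ×
      (∀ α β → [ α ·ᵃ FX.ã , β ·ᵃ FX.ã ]′ ⊨ θ → [ α ·ᵃ FY.ã , β ·ᵃ FY.ã ]′ ⊨ η → [ α · c , β · c ]′ ⊨ E n)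
    separate n =
      let θ , tθ , hθ = shrink W≺κ fX FX.closed-D (closed-∩ (closed-∘ fY FY.closed-D) closed-C) χ
            (λ ρ d (d′ , o , o′) → corner ρ d d′ o o′)
          η , tη , hη = shrink W≺κ fY FY.closed-D (closed-∩ (closed-∘ fX (closed-⊨ θ)) closed-C) χ
            (λ ρ d (q , o) → hθ ρ q (d , o))
      in θ , η , tθ , tη , λ α β p q →
        ⊨-≗ (E n) (λ { (inj₁ _) → refl ; (inj₂ _) → refl })
          (to (⊨-mapVars fZ (E n)) (hη [ α ·ᵃ FX.abc , β ·ᵃ FX.abc ]′
            (⊨-≗ η (λ { (inj₁ _) → refl ; (inj₂ _) → refl }) q)
            (⊨-≗ θ (λ { (inj₁ _) → refl ; (inj₂ _) → refl }) p , (α , λ _ → refl) , (β , λ _ → refl))))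
      where
      W : Set
      W = FX.Joint ⊎ FX.Joint

      W≺κ : W ≺κ
      W≺κ = ⊎-≺κ ℕ≺κ FX.Joint≺κ FX.Joint≺κ

      fX : FX.V ⊎ FX.V → W
      fX = Sum.map inj₁ inj₁

      fY : FY.V ⊎ FY.V → W
      fY = Sum.map (inj₂ ∘ inj₁) (inj₂ ∘ inj₁)

      fZ : ℕ ⊎ ℕ → W
      fZ = Sum.map (inj₂ ∘ inj₂) (inj₂ ∘ inj₂)

      C : Pred (W → M) 0ℓ
      C ρ = Orb FX.abc (ρ ∘ inj₁) × Orb FX.abc (ρ ∘ inj₂)

      closed-C : Closed C
      closed-C = closed-∩ (closed-∘ inj₁ (closed-Orb FX.Joint≺κ FX.abc)) (closed-∘ inj₂ (closed-Orb FX.Joint≺κ FX.abc))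

      χ : FormulaIn L W
      χ = mapVars fZ (E n)

      corner : ∀ ρ → FX.D (ρ ∘ fX) → FY.D (ρ ∘ fY) → Orb FX.abc (ρ ∘ inj₁) → Orb FX.abc (ρ ∘ inj₂) → ρ ⊨ χ
      corner ρ (α₁ , β₁ , e₁ , f₁ , r₁) (α₂ , β₂ , e₂ , f₂ , r₂) (α , eα) (β , eβ) =
        from (⊨-mapVars fZ (E n))
          (⊨-≗ (E n) (λ { (inj₁ k) → eα (inj₂ (inj₂ k)) ; (inj₂ k) → eβ (inj₂ (inj₂ k)) })
            (R.corners {α} {β}
              (FX.D-elim α β (α₁ , β₁ , (λ v → trans (e₁ v) (sym (eα (inj₁ v)))) ,
                                        (λ v → trans (f₁ v) (sym (eβ (inj₁ v)))) , r₁))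
              (FY.D-elim α β (α₂ , β₂ , (λ v → trans (e₂ v) (sym (eα (inj₂ (inj₁ v))))) ,
                                        (λ v → trans (f₂ v) (sym (eβ (inj₂ (inj₁ v))))) , r₂))
              n))

    -- `c 0` supplies an element of the model for coordinates that code no variable.
    module PX = Presentation FX.V≺κ FX.D FX.closed-D FX.D-sym FX.D-trans FX.ã FX.D-refl
      (λ n → proj₁ (separate n)) (λ n → proj₁ (proj₂ (proj₂ (separate n)))) (c 0)

    module PY = Presentation FY.V≺κ FY.D FY.closed-D FY.D-sym FY.D-trans FY.ã FY.D-refl
      (λ n → proj₁ (proj₂ (separate n))) (λ n → proj₁ (proj₂ (proj₂ (proj₂ (separate n))))) (c 0)

    x : Hyperimaginary
    x = PX.hyperimaginary

    y : Hyperimaginary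
    y = PY.hyperimaginary

    private
      module CX = Conjugacy (classConjugacy x)
      module CY = Conjugacy (classConjugacy y)

    fibre⇒x : ∀ α β → α FX.≈ᶠ β → α CX.≈ β
    fibre⇒x α β r = PX.coarser α β (FX.D-intro α β r)

    fibre⇒y : ∀ α β → α FY.≈ᶠ β → α CY.≈ β
    fibre⇒y α β r = PY.coarser α β (FY.D-intro α β r)

    a⇒x : ∀ α β → α A.≈ β → α CX.≈ β
    a⇒x α β e = fibre⇒x α β (FX.≈ᶠ-of-≈ {α} {β} e)

    b⇒y : ∀ α β → α B.≈ β → α CY.≈ β
    b⇒y α β e = fibre⇒y α β (FY.≈ᶠ-of-≈ {α} {β} e)

    xy⇒z : ∀ α β → α CX.≈ β → α CY.≈ β → α Z.≈ β
    xy⇒z α β p q n = proj₂ (proj₂ (proj₂ (proj₂ (separate n)))) α β (PX.finer α β p n) (PY.finer α β q n)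

    x-fixed : ∀ σ τ → σ Z.≈ idᴬ → τ CX.≈ idᴬ → τ ∘ᴬ σ CX.≈ σ
    x-fixed = FX.fixed-conjugate (classConjugacy x) (classConjugacy y) fibre⇒x b⇒y xy⇒z

    y-fixed : ∀ σ τ → σ Z.≈ idᴬ → τ CY.≈ idᴬ → τ ∘ᴬ σ CY.≈ σ
    y-fixed = FY.fixed-conjugate (classConjugacy y) (classConjugacy x) fibre⇒y a⇒x (λ α β q p → xy⇒z α β p q)

    conclusion : x ∈ bdd[ X ] (class z ∷ []) ×
                 y ∈ bdd[ Y ] (class z ∷ []) ×
                 z ∈ dcl (class x ∷ class y ∷ [])
    conclusion =
      ( bdd-criterion {B = class z ∷ []} x (λ σ τ fix τx → x-fixed σ τ (fix zero) τx)
      , I , I≺κ , a , λ σ fix → a⇒x σ idᴬ fix ) ,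
      ( bdd-criterion {B = class z ∷ []} y (λ σ τ fix τy → y-fixed σ τ (fix zero) τy)
      , J , J≺κ , b , λ σ fix → b⇒y σ idᴬ fix ) ,
      λ σ fix → xy⇒z σ idᴬ (fix zero) (fix (suc zero))

  module Parts {S T I : Set} (I≺κ : I ≺κ) (c : I → S ⊎ T) where
    -- The equation ties `s` to `i`; by `uip` it carries no further information, so `Left` embeds in
    -- `I` and is small.
    Left : Set
    Left = Σ[ i ∈ I ] Σ[ s ∈ S ] c i ≡ inj₁ s

    Right : Set
    Right = Σ[ i ∈ I ] Σ[ t ∈ T ] c i ≡ inj₂ t

    left-≺κ : Left ≺κ
    left-≺κ = ≺κ-↣ (mk↣ inj) I≺κ
      where
      inj : ∀ {p q : Left} → proj₁ p ≡ proj₁ q → p ≡ q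
      inj {i , s , e} {.i , t , f} refl with trans (sym e) f
      ... | refl = cong (λ g → i , s , g) (uip e f)

    right-≺κ : Right ≺κ
    right-≺κ = ≺κ-↣ (mk↣ inj) I≺κ
      where
      inj : ∀ {p q : Right} → proj₁ p ≡ proj₁ q → p ≡ q
      inj {i , s , e} {.i , t , f} refl with trans (sym e) f
      ... | refl = cong (λ g → i , s , g) (uip e f)

  weak-elimination : (X Y : HyperdefinableSet) → X ⊥∅ Y → ∀ z → z ∈ [ X ∪ Y ]^heq →
    ∃[ x ] ∃[ y ]
      (x ∈ bdd[ X ] (class z ∷ []) ×
       y ∈ bdd[ Y ] (class z ∷ []) ×
       z ∈ dcl (class x ∷ class y ∷ []))
  weak-elimination X Y X⊥Y z (I , I≺κ , w , z∈dcl) = x , y , conclusion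
    where
    open Parts I≺κ w

    a : Left → Element X
    a (_ , s , _) = s

    b : Right → Element Y
    b (_ , t , _) = t

    module A = Conjugacy (Tuples.tupleConjugacy X a)
    module B = Conjugacy (Tuples.tupleConjugacy Y b)
    module Z = Conjugacy (classConjugacy z)

    det : Determines (Tuples.tupleConjugacy X a) (Tuples.tupleConjugacy Y b) (classConjugacy z)
    det γ δ p q = Z.from-identity γ δ (z∈dcl (δ ⁻¹ ∘ᴬ γ) fixes-w)
      where
      fixes-w : FixesPointwise (δ ⁻¹ ∘ᴬ γ) ([ element X , element Y ]′ ∘ w)
      fixes-w i with w i in eq
      ... | inj₁ s = A.to-identity γ {δ} p (i , s , eq)
      ... | inj₂ t = B.to-identity γ {δ} q (i , t , eq)

    open Elimination X Y left-≺κ right-≺κ a b z (orthogonal X Y X⊥Y left-≺κ right-≺κ a b) det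

mainTheorem6 : ExcludedMiddle 0ℓ → Extensionality 0ℓ 0ℓ →
    (𝕄 : MonsterModel) → let open Hyperimaginaries 𝕄 in
    (X Y : HyperdefinableSet) → X ⊥∅ Y →
    ∀ z → z ∈ [ X ∪ Y ]^heq →
    ∃[ x ] ∃[ y ]
    (x ∈ bdd[ X ] (class z ∷ []) ×
    y ∈ bdd[ Y ] (class z ∷ []) ×
    z ∈ dcl (class x ∷ class y ∷ []))
mainTheorem6 em ext 𝕄 = Model.weak-elimination em ext 𝕄
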